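{- Let $q$ be a prime power, $\chi$ a multiplicative character of $\mathbb{F}_q^*$ and $\lambda$ an additive character of $\mathbb{F}_q$. For every $n\ge 1$, \[ \sum_{g\in GL(n,q)}\chi(\det g)\,\lambda(\operatorname{tr} g) = \begin{cases} |GL(n,q)| & \text{if } \lambda,\chi \text{ are both trivial},\\ 0 & \text{if } \lambda \text{ is trivial and } \chi \text{ nontrivial},\\ q^{\binom n2}\,G(\chi,\lambda)^n & \text{if } \lambda \text{ is nontrivial}.\end{cases}\]
   Context: $GL(n,q)$ is the group of invertible $n\times n$ matrices over $\mathbb{F}_q$. The Gauss sum is $G(\chi,\lambda)=\sum_{x\in\mathbb{F}_q^*}\chi(x)\lambda(x)$. -}

module Defs where

open import Level using (Level; _⊔_)
open import Algebra.Apartness.Bundles using (HeytingField; HeytingCommutativeRing)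
open import Algebra.Bundles
  using (Magma; Monoid; Group; Semiring; CommutativeRing)
import Algebra.Definitions as AlgebraDefinitions
import Algebra.Definitions.RawSemiring as RawSemiringDefinitions
open import Algebra.Morphism.Bundles using (GroupHomomorphism)
import Algebra.Properties.CommutativeMonoid.Sum as CommutativeMonoidSum
open import Data.Fin.Base using (Fin; zero; suc; toℕ; punchIn; combine; finToFun; funToFin)
import Data.Fin.Properties as Fin
open import Data.List.Base as List using (List)
open import Data.Maybe.Base as Maybe using ()
open import Data.Nat.Base as ℕ using (ℕ; zero; suc; _≤_)
open import Data.Nat.Primality using (Prime)
open import Data.Product.Base using (∃; ∃₂; _×_; _,_; proj₁; proj₂)
open import Data.Vec.Functional using (Vector)
import Data.Vec.Functional.Relation.Binary.Equality.Setoid as VecEquality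
open import Function.Base using (_∘_; _on_)
open import Function.Bundles using (Inverse)
open import Function.Properties.Inverse using (Inverse⇒Injection)
open import Relation.Binary.Bundles using (Setoid)
open import Relation.Binary.Definitions using (_Respects_)
  renaming (Decidable to Decidable₂)
open import Relation.Binary.PropositionalEquality as ≡ using (_≡_)
import Relation.Binary.Reasoning.Setoid as SetoidReasoning
open import Relation.Nullary using (¬_; Dec; yes; no)
open import Relation.Nullary.Decidable using (map′; _×-dec_; via-injection; dec⇒maybe)
open import Relation.Unary using (Pred; Decidable)

private
  variable
    a b c ℓ p ℓ₁ ℓ₂ : Level

IsPrimePower : ℕ → Set
IsPrimePower q = ∃₂ λ p k → Prime p × 1 ≤ k × q ≡ p ℕ.^ k

-- S has exactly n elements up to its equality.
Finite : Setoid a ℓ → ℕ → Set _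
Finite S n = Inverse S (≡.setoid (Fin n))

module _ {S : Setoid a ℓ} {n : ℕ} (fin : Finite S n) where
  open Setoid S
  open Inverse fin

  elements : List Carrier
  elements = List.map from (List.allFin n)

  decEq : Decidable₂ _≈_
  decEq = via-injection (Inverse⇒Injection fin) Fin._≟_

  ∃? : {P : Pred Carrier p} → P Respects _≈_ → Decidable P → Dec (∃ P)
  ∃? resp P? = map′
    (λ (i , Pi) → from i , Pi)
    (λ (x , Px) → to x , resp (sym (strictlyInverseʳ x)) Px)
    (Fin.any? (P? ∘ from))

VectorSetoid : Setoid a ℓ → ℕ → Setoid a ℓ
VectorSetoid S n = VecEquality.≋-setoid S n

finiteVectors : {S : Setoid a ℓ} {m : ℕ} → Finite S m →
                (n : ℕ) → Finite (VectorSetoid S n) (m ℕ.^ n)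
finiteVectors {S = S} fin n = record
  { to        = toV
  ; from      = fromV
  ; to-cong   = toV-cong
  ; from-cong = λ { ≡.refl i → S.refl }
  ; inverse   =
      (λ {i} v≈ → ≡.trans (toV-cong v≈) (toV-fromV i))
    , (λ { {v} ≡.refl → fromV-toV v })
  }
  where
  module S = Setoid S
  open Inverse fin

  toV : Vector S.Carrier n → Fin _
  toV v = funToFin (to ∘ v)

  fromV : Fin _ → Vector S.Carrier n
  fromV k i = from (finToFun k i)

  funToFin-cong : ∀ {n m} {f g : Fin n → Fin m} →
                  (∀ i → f i ≡ g i) → funToFin f ≡ funToFin g
  funToFin-cong {zero}  f≗g = ≡.refl
  funToFin-cong {suc n} f≗g =
    ≡.cong₂ combine (f≗g zero) (funToFin-cong (f≗g ∘ suc))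

  toV-cong : ∀ {v w} → (∀ i → v i S.≈ w i) → toV v ≡ toV w
  toV-cong v≈w = funToFin-cong (to-cong ∘ v≈w)

  toV-fromV : ∀ k → toV (fromV k) ≡ k
  toV-fromV k = ≡.trans
    (funToFin-cong {n} (λ i → strictlyInverseˡ (finToFun k i)))
    (Fin.funToFin-finToFin {n} k)

  fromV-toV : ∀ v i → fromV (toV v) i S.≈ v i
  fromV-toV v i = S.trans
    (from-cong (Fin.finToFun-funToFin (to ∘ v) i))
    (strictlyInverseʳ (v i))

module Invertibles (M : Magma a ℓ) (ε : Magma.Carrier M) where
  open Magma M
  open AlgebraDefinitions _≈_ using (Invertible)

  Unit : Set _
  Unit = ∃ (Invertible ε _∙_)

  invertible? : ∀ {n} → Finite setoid n → Decidable (Invertible ε _∙_)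
  invertible? fin x = ∃? fin
    (λ y≈z (yx , xy) → trans (∙-congʳ (sym y≈z)) yx , trans (∙-congˡ (sym y≈z)) xy)
    (λ y → decEq fin (y ∙ x) ε ×-dec decEq fin (x ∙ y) ε)

  units : ∀ {n} → Finite setoid n → List Unit
  units fin = List.mapMaybe
    (λ x → Maybe.map (x ,_) (dec⇒maybe (invertible? fin x)))
    (elements fin)

-- The equality on units ignores the choice of inverse.
unitGroup : Monoid a ℓ → Group (a ⊔ ℓ) ℓ
unitGroup M = record
  { Carrier = Unit
  ; _≈_     = _≈_ on proj₁
  ; _∙_     = λ (x , x⁻¹ , x⁻¹x , xx⁻¹) (y , y⁻¹ , y⁻¹y , yy⁻¹) →
                x ∙ y , y⁻¹ ∙ x⁻¹ , cancel x⁻¹x y⁻¹y , cancel yy⁻¹ xx⁻¹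
  ; ε       = ε , ε , identityˡ ε , identityˡ ε
  ; _⁻¹     = λ (x , x⁻¹ , x⁻¹x , xx⁻¹) → x⁻¹ , x , xx⁻¹ , x⁻¹x
  ; isGroup = record
    { isMonoid = record
      { isSemigroup = record
        { isMagma = record
          { isEquivalence = record { refl = refl ; sym = sym ; trans = trans }
          ; ∙-cong        = ∙-cong
          }
        ; assoc = λ (x , _) (y , _) (z , _) → assoc x y z
        }
      ; identity = (λ (x , _) → identityˡ x) , (λ (x , _) → identityʳ x)
      }
    ; inverse = (λ (_ , _ , x⁻¹x , _) → x⁻¹x) , (λ (_ , _ , _ , xx⁻¹) → xx⁻¹)
    ; ⁻¹-cong = λ {u} {v} → ⁻¹-unique u v
    }
  }
  where
  open Monoid M
  open Invertibles magma ε using (Unit)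
  open SetoidReasoning setoid

  cancel : ∀ {w x y z} → x ∙ y ≈ ε → w ∙ z ≈ ε → (w ∙ x) ∙ (y ∙ z) ≈ ε
  cancel {w} {x} {y} {z} xy wz = begin
    (w ∙ x) ∙ (y ∙ z)  ≈⟨ assoc w x (y ∙ z) ⟩
    w ∙ (x ∙ (y ∙ z))  ≈⟨ ∙-congˡ (assoc x y z) ⟨
    w ∙ ((x ∙ y) ∙ z)  ≈⟨ ∙-congˡ (∙-congʳ xy) ⟩
    w ∙ (ε ∙ z)        ≈⟨ ∙-congˡ (identityˡ z) ⟩
    w ∙ z              ≈⟨ wz ⟩
    ε                  ∎

  ⁻¹-unique : ((x , x⁻¹ , _) (y , y⁻¹ , _) : Unit) → x ≈ y → x⁻¹ ≈ y⁻¹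
  ⁻¹-unique (x , x⁻¹ , x⁻¹x , _) (y , y⁻¹ , _ , yy⁻¹) x≈y = begin
    x⁻¹              ≈⟨ identityʳ x⁻¹ ⟨
    x⁻¹ ∙ ε          ≈⟨ ∙-congˡ yy⁻¹ ⟨
    x⁻¹ ∙ (y ∙ y⁻¹)  ≈⟨ assoc x⁻¹ y y⁻¹ ⟨
    (x⁻¹ ∙ y) ∙ y⁻¹  ≈⟨ ∙-congʳ (∙-congˡ x≈y) ⟨
    (x⁻¹ ∙ x) ∙ y⁻¹  ≈⟨ ∙-congʳ x⁻¹x ⟩
    ε ∙ y⁻¹          ≈⟨ identityˡ y⁻¹ ⟩
    y⁻¹              ∎

module Matrices (R : CommutativeRing a ℓ) where
  open CommutativeRing R hiding (zero)
  open RawSemiringDefinitions (Semiring.rawSemiring semiring) using (_^_)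
  open CommutativeMonoidSum +-commutativeMonoid using (sum; sum-cong-≋)

  Matrix : ℕ → Set a
  Matrix n = Vector (Vector Carrier n) n

  matrixSetoid : ℕ → Setoid a ℓ
  matrixSetoid n = VectorSetoid (VectorSetoid setoid n) n

  1ₘ : ∀ {n} → Matrix n
  1ₘ zero    zero    = 1#
  1ₘ zero    (suc j) = 0#
  1ₘ (suc i) zero    = 0#
  1ₘ (suc i) (suc j) = 1ₘ i j

  infixl 7 _*ₘ_

  _*ₘ_ : ∀ {n} → Matrix n → Matrix n → Matrix n
  (A *ₘ B) i j = sum (λ k → A i k * B k j)

  *ₘ-magma : ℕ → Magma a ℓ
  *ₘ-magma n = record
    { Carrier = Matrix n
    ; _∙_     = _*ₘ_
    ; isMagma = record
      { isEquivalence = Setoid.isEquivalence (matrixSetoid n)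
      ; ∙-cong        = λ A≈A′ B≈B′ i j → sum-cong-≋ (λ k → *-cong (A≈A′ i k) (B≈B′ k j))
      }
    }

  tr : ∀ {n} → Matrix n → Carrier
  tr A = sum (λ i → A i i)

  minor : ∀ {n} → Fin (suc n) → Matrix (suc n) → Matrix n
  minor j A i k = A (suc i) (punchIn j k)

  -- Laplace expansion along the first row.
  det : ∀ {n} → Matrix n → Carrier
  det {zero}  A = 1#
  det {suc n} A = sum (λ j → (- 1#) ^ toℕ j * (A zero j * det (minor j A)))

  finiteMatrices : ∀ {q} → Finite setoid q → (n : ℕ) →
                   Finite (matrixSetoid n) ((q ℕ.^ n) ℕ.^ n)
  finiteMatrices fin n = finiteVectors (finiteVectors fin n) n

  GL : ℕ → Set _
  GL n = Invertibles.Unit (*ₘ-magma n) 1ₘ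

  elementsGL : ∀ {q} → Finite setoid q → (n : ℕ) → List (GL n)
  elementsGL fin n = Invertibles.units (*ₘ-magma n) 1ₘ (finiteMatrices fin n)

ringOf : HeytingField c ℓ₁ ℓ₂ → CommutativeRing c ℓ₁
ringOf F = HeytingCommutativeRing.commutativeRing (HeytingField.heytingCommutativeRing F)

setoidOf : HeytingField c ℓ₁ ℓ₂ → Setoid c ℓ₁
setoidOf F = CommutativeRing.setoid (ringOf F)

infix 30 _⁺ _ˣ

_⁺ : HeytingField c ℓ₁ ℓ₂ → Group c ℓ₁
F ⁺ = CommutativeRing.+-group (ringOf F)

_ˣ : HeytingField c ℓ₁ ℓ₂ → Group (c ⊔ ℓ₁) ℓ₁
F ˣ = unitGroup (CommutativeRing.*-monoid (ringOf F))

CharacteristicZero : HeytingField c ℓ₁ ℓ₂ → Set ℓ₁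
CharacteristicZero K = ∀ n → ¬ (suc n ×ᴷ 1# ≈ 0#)
  where
  open CommutativeRing (ringOf K)
  open RawSemiringDefinitions (Semiring.rawSemiring semiring) using () renaming (_×_ to _×ᴷ_)

-- The values of characters are roots of unity, so K may be any field of
-- characteristic zero; the complex numbers are the usual choice.
Character : Group a ℓ → HeytingField c ℓ₁ ℓ₂ → Set _
Character G K = GroupHomomorphism (Group.rawGroup G) (Group.rawGroup (K ˣ))

Trivial : (G : Group a ℓ) (K : HeytingField c ℓ₁ ℓ₂) → Character G K → Set _
Trivial G K χ = ∀ x → ⟦ x ⟧ ≈ ε
  where
  open GroupHomomorphism χ
  open Group (K ˣ)

module CharacterSums
  {c ℓ₁ ℓ₂ c′ ℓ₁′ ℓ₂′ : Level}
  (F : HeytingField c ℓ₁ ℓ₂) {q : ℕ} (fin : Finite (setoidOf F) q)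
  (K : HeytingField c′ ℓ₁′ ℓ₂′)
  (χ : Character (F ˣ) K) (ψ : Character (F ⁺) K)
  where

  private
    module F = CommutativeRing (ringOf F)
    module χ = GroupHomomorphism χ
    module ψ = GroupHomomorphism ψ
  open CommutativeRing (ringOf K) hiding (_≈_; _*_; 0#)
  open CommutativeRing (ringOf K) public using (_≈_; _*_; 0#)
  open RawSemiringDefinitions (Semiring.rawSemiring semiring) public using (_^_)
  open RawSemiringDefinitions (Semiring.rawSemiring semiring) using () renaming (_×_ to _×ᴷ_)
  open Invertibles F.*-magma F.1# using (Unit; units; invertible?)
  open Matrices (ringOf F)

  fromℕ : ℕ → Carrier
  fromℕ m = m ×ᴷ 1#

  ∑ : {A : Set a} → List A → (A → Carrier) → Carrier
  ∑ xs f = List.foldr _+_ 0# (List.map f xs)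

  -- χ is extended by zero to F. The extension is only applied to determinants
  -- of invertible matrices, which are units, so the value 0 is never used.
  χ₀ : F.Carrier → Carrier
  χ₀ x with invertible? fin x
  ... | yes x-unit = proj₁ χ.⟦ x , x-unit ⟧
  ... | no  _      = 0#

  gaussSum : Carrier
  gaussSum = ∑ (units fin) λ u → proj₁ χ.⟦ u ⟧ * proj₁ ψ.⟦ proj₁ u ⟧

  sumGL : ℕ → Carrier
  sumGL n = ∑ (elementsGL fin n) λ (g , _) → χ₀ (det g) * proj₁ ψ.⟦ tr g ⟧

  orderGL : ℕ → ℕ
  orderGL n = List.length (elementsGL fin n)

{-# OPTIONS --safe #-}

-- Write A as a top row r over the remaining rows B and fix B. Replacing r by a
-- combination of all rows of A multiplies det A by the coefficient of r and keeps
-- invertibility when that coefficient is a unit. Adding Σ vᵢ Bᵢ to r changes only the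
-- trace, by Σ vᵢ Bᵢ₀, so for nontrivial ψ the sum over r is fixed by multiplication
-- by every ψ x and vanishes unless the first column of B is zero. The remaining
-- matrices are block upper triangular and contribute q ^ n · G · (the sum over GL n),
-- which gives the exponent 0 + 1 + … + (n ∸ 1). For trivial ψ and nontrivial χ,
-- scaling r by a unit does the same.
module Submission where

open import Defs
open import Level using (Level)
open import Algebra.Apartness.Bundles using (HeytingField)
open import Algebra.Bundles using (Group; Magma; Monoid; CommutativeRing; Semiring)
import Algebra.Definitions as AlgebraDefinitions
import Algebra.Definitions.RawSemiring as RawSemiringDefinitions
open import Algebra.Morphism.Bundles using (GroupHomomorphism)
import Algebra.Properties.Ring as RingProperties
import Algebra.Properties.Semiring.Mult as SemiringMult
import Algebra.Properties.Semiring.Sum as SemiringSum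
import Algebra.Solver.Ring.NaturalCoefficients.Default as RingSolver
open import Data.Empty using (⊥-elim)
open import Data.Fin.Base as Fin using (Fin; zero; suc; toℕ; punchIn; inject₁)
import Data.Fin.Properties as Fin
open import Data.List.Base as List using (List)
open import Data.Maybe.Base as Maybe using (Maybe; just; nothing; maybe)
open import Data.Nat.Base as ℕ using (ℕ; zero; suc; _≤_; z≤n; s≤s)
open import Data.Nat.Combinatorics using (_C_; nC1≡n; nCk+nC[k+1]≡[n+1]C[k+1])
import Data.Nat.Properties as ℕ
open import Data.Product.Base using (∃; _×_; _,_; proj₁; proj₂)
open import Data.Sum.Base using (_⊎_; inj₁; inj₂)
open import Data.Unit.Base using (tt)
open import Data.Vec.Functional using (Vector; []; _∷_; tail; removeAt)
open import Function.Base using (_∘_; id)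
open import Function.Bundles using (Inverse)
open import Function.Construct.Composition using (inverse)
open import Function.Construct.Symmetry using () renaming (inverse to symmetry)
open import Function.Definitions using (Congruent)
open import Relation.Binary.Bundles using (Setoid)
open import Relation.Binary.PropositionalEquality as ≡ using (_≡_; _≢_)
import Relation.Binary.Reasoning.Setoid as SetoidReasoning
open import Relation.Nullary using (¬_; Dec; yes; no; contradiction)
open import Relation.Nullary.Decidable using (dec⇒maybe)

private
  variable
    a ℓ : Level
    n : ℕ

-- `det` is given by expansion along the first row, while `GL` consists of matrices with a two-sided
-- inverse. The two notions meet in the top row: replacing it is left multiplication by an
-- elementary matrix, which preserves invertibility, and its effect on `det` follows from linearity
-- in that row together with the vanishing of `det` when the top row recurs below. The latter is the
-- one genuinely combinatorial fact, and it comes from pairing the terms of a double expansion. The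
-- vanishing steps need care because equality in `K` need not be decidable: a sum is shown to be
-- zero by refuting that it is apart from zero. In `F` finiteness supplies the missing decisions.
-- Rows can be varied freely only if the summation range is all matrices, so sums over `GL` become
-- sums over all matrices with weight zero off `GL`.

module MonoidUnits (M : Monoid a ℓ) where
  open Monoid M
  open AlgebraDefinitions _≈_ using () renaming (Invertible to InvertibleIn)

  Invertible : Carrier → Set _
  Invertible = InvertibleIn ε _∙_

  Invertible-resp : ∀ {x y} → x ≈ y → Invertible x → Invertible y
  Invertible-resp x≈y (z , zx , xz) =
    z , trans (∙-congˡ (sym x≈y)) zx , trans (∙-congʳ (sym x≈y)) xz

  Invertible-∙ : ∀ {x y} → Invertible x → Invertible y → Invertible (x ∙ y)
  Invertible-∙ ux uy = proj₂ (Group._∙_ (unitGroup M) (_ , ux) (_ , uy))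

  Invertible-cancelˡ : ∀ {x y} → Invertible x → Invertible (x ∙ y) → Invertible y
  Invertible-cancelˡ {x} {y} (x⁻¹ , x⁻¹x , xx⁻¹) uxy = Invertible-resp
    (trans (sym (assoc x⁻¹ x y)) (trans (∙-congʳ x⁻¹x) (identityˡ y)))
    (Invertible-∙ (x , xx⁻¹ , x⁻¹x) uxy)

-- Deleting two indices in either order.

punchIn-inject₁ : {i k : Fin n} → i Fin.≤ k → punchIn (inject₁ i) k ≡ suc k
punchIn-inject₁ {i = zero}              _         = ≡.refl
punchIn-inject₁ {i = suc i} {k = suc k} (s≤s i≤k) = ≡.cong suc (punchIn-inject₁ i≤k)

punchIn-suc : {i k : Fin n} → i Fin.≤ k → punchIn (suc k) i ≡ inject₁ i
punchIn-suc {i = zero}              _         = ≡.refl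
punchIn-suc {i = suc i} {k = suc k} (s≤s i≤k) = ≡.cong suc (punchIn-suc i≤k)

-- Deleting the smaller index first moves the larger one, `suc k`, down to position `k`; deleting
-- the larger first leaves the smaller at position `i`. Either way the same two indices are gone.
punchIn-comm : {i k : Fin (suc n)} → i Fin.≤ k → ∀ l →
               punchIn (inject₁ i) (punchIn k l) ≡ punchIn (suc k) (punchIn i l)
punchIn-comm {i = zero}              _         l       = ≡.refl
punchIn-comm {i = suc i} {k = suc k} (s≤s i≤k) zero    = ≡.refl
punchIn-comm {i = suc i} {k = suc k} (s≤s i≤k) (suc l) = ≡.cong suc (punchIn-comm i≤k l)

-- Determinants by expansion along the first row.

module Determinants (R : CommutativeRing a ℓ) where
  open CommutativeRing R hiding (zero)
  open Matrices R
  open RawSemiringDefinitions (Semiring.rawSemiring semiring) using (_^_)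
  open SemiringSum semiring
    using (sum; sum-cong-≋; sum-replicate-zero; sum-remove; ∑-distrib-+; ∑-comm; *-distribˡ-sum; *-distribʳ-sum)
  open RingSolver commutativeSemiring using (solve; _:=_; _:+_; _:*_; con)
  open RingProperties ring using (-‿distribˡ-*; -‿distribʳ-*; -‿involutive)
  open MonoidUnits *-monoid
  open SetoidReasoning setoid

  sum-zero : {f : Vector Carrier n} → (∀ i → f i ≈ 0#) → sum f ≈ 0#
  sum-zero {n} f≈0 = trans (sum-cong-≋ f≈0) (sum-replicate-zero n)

  sum-single : {f : Vector Carrier n} (i : Fin n) → (∀ j → j ≢ i → f j ≈ 0#) → sum f ≈ f i
  sum-single {suc n} {f} i f≈0 = begin
    sum f                      ≈⟨ sum-remove f ⟩
    f i + sum (removeAt f i)   ≈⟨ +-congˡ (sum-zero (λ j → f≈0 _ (Fin.punchInᵢ≢i i j))) ⟩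
    f i + 0#                   ≈⟨ +-identityʳ _ ⟩
    f i                        ∎

  -- The pairs (inject₁ i , k) and (suc k , i) with i ≤ k punch out the same two indices.
  sum-antisym : (g : Fin (suc n) → Fin n → Carrier) →
                (∀ {i k} → i Fin.≤ k → g (inject₁ i) k + g (suc k) i ≈ 0#) →
                sum (λ j → sum (g j)) ≈ 0#
  sum-antisym {zero}  g _      = +-identityˡ 0#
  sum-antisym {suc n} g cancel = begin
    sum (g zero) + sum (λ j → g (suc j) zero + sum (λ k → g (suc j) (suc k)))
      ≈⟨ +-congˡ (∑-distrib-+ (λ j → g (suc j) zero) (λ j → sum (λ k → g (suc j) (suc k)))) ⟩
    sum (g zero) + (sum (λ j → g (suc j) zero) + sum (λ j → sum (λ k → g (suc j) (suc k))))
      ≈⟨ +-congˡ (+-congˡ (sum-antisym (λ j k → g (suc j) (suc k)) (λ i≤k → cancel (s≤s i≤k)))) ⟩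
    sum (g zero) + (sum (λ j → g (suc j) zero) + 0#)
      ≈⟨ +-congˡ (+-identityʳ _) ⟩
    sum (g zero) + sum (λ j → g (suc j) zero)
      ≈⟨ ∑-distrib-+ (g zero) (λ j → g (suc j) zero) ⟨
    sum (λ k → g zero k + g (suc k) zero)
      ≈⟨ sum-zero (λ k → cancel {zero} {k} z≤n) ⟩
    0# ∎

  sgn : Fin n → Carrier
  sgn j = (- 1#) ^ toℕ j

  det-cong : {A B : Matrix n} → (∀ i j → A i j ≈ B i j) → det A ≈ det B
  det-cong {zero}  A≈B = refl
  det-cong {suc n} A≈B = sum-cong-≋ λ j →
    *-congˡ {x = sgn j} (*-cong (A≈B zero j) (det-cong (λ i k → A≈B (suc i) (punchIn j k))))

  private
    -- `M c` stands for the minor of the rows below the first two on the columns selected by `c`.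
    -- Keeping it abstract lets one cancellation serve a matrix and its row swap, which share these
    -- minors. `M-cong` is required because the selections arising from the two orders of deletion
    -- agree only pointwise.
    module DoubleExpansion {n} (M : (Fin n → Fin (suc (suc n))) → Carrier)
      (M-cong : ∀ {c d} → (∀ l → c l ≡ d l) → M c ≈ M d) where

      term : (u v : Vector Carrier (suc (suc n))) → Fin (suc (suc n)) → Fin (suc n) → Carrier
      term u v j k = sgn j * (u j * (sgn k * (v (punchIn j k) * M (punchIn j ∘ punchIn k))))

      -- Both terms carry the same two entries and the same minor. Their signs differ by the one
      -- factor `- 1#` that `sgn (suc k)` has beyond `sgn k`, so `1# + - 1#` factors out.
      term-cancel : ∀ u v {i k} → i Fin.≤ k → term u v (inject₁ i) k + term v u (suc k) i ≈ 0#
      term-cancel u v {i} {k} i≤k = begin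
        term u v (inject₁ i) k + term v u (suc k) i
          ≈⟨ +-cong
               (*-cong (reflexive (≡.cong ((- 1#) ^_) (Fin.toℕ-inject₁ i)))
                 (*-congˡ (*-congˡ (*-cong (reflexive (≡.cong v (punchIn-inject₁ i≤k)))
                   (M-cong (punchIn-comm i≤k))))))
               (*-congˡ (*-congˡ (*-congˡ (*-congʳ (reflexive (≡.cong u (punchIn-suc i≤k))))))) ⟩
        sgn i * (uᵢ * (sgn k * (vₖ * m))) + (- 1# * sgn k) * (vₖ * (sgn i * (uᵢ * m)))
          ≈⟨ solve 6 (λ e s x t y m →
               s :* (x :* (t :* (y :* m))) :+ (e :* t) :* (y :* (s :* (x :* m)))
               := (con 1 :+ e) :* (s :* (x :* (t :* (y :* m))))) refl
               (- 1#) (sgn i) uᵢ (sgn k) vₖ m ⟩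
        (1# + - 1#) * _  ≈⟨ *-congʳ (-‿inverseʳ 1#) ⟩
        0# * _           ≈⟨ zeroˡ _ ⟩
        0#               ∎
        where
        uᵢ = u (inject₁ i)
        vₖ = v (suc k)
        m  = M (punchIn (suc k) ∘ punchIn i)

    open DoubleExpansion

    lowerMinor : Matrix (suc (suc n)) → (Fin n → Fin (suc (suc n))) → Carrier
    lowerMinor A c = det (λ r l → A (suc (suc r)) (c l))

    lowerMinor-cong : (A : Matrix (suc (suc n))) → ∀ {c d} → (∀ l → c l ≡ d l) →
                      lowerMinor A c ≈ lowerMinor A d
    lowerMinor-cong A c≡d = det-cong (λ r l → reflexive (≡.cong (A (suc (suc r))) (c≡d l)))

    expansion : Matrix (suc (suc n)) → (u v : Vector Carrier (suc (suc n))) →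
                Fin (suc (suc n)) → Fin (suc n) → Carrier
    expansion A = term (lowerMinor A) (lowerMinor-cong A)

    det-expand : (A : Matrix (suc (suc n))) →
                 det A ≈ sum (λ j → sum (expansion A (A zero) (A (suc zero)) j))
    det-expand A = sum-cong-≋ λ j → begin
      sgn j * (A zero j * sum (inner j))
        ≈⟨ *-congˡ (*-distribˡ-sum (A zero j) (inner j)) ⟩
      sgn j * sum (λ k → A zero j * inner j k)
        ≈⟨ *-distribˡ-sum (sgn j) (λ k → A zero j * inner j k) ⟩
      sum (expansion A (A zero) (A (suc zero)) j) ∎
      where
      inner : _ → _ → Carrier
      inner j k = sgn k * (A (suc zero) (punchIn j k) * lowerMinor A (punchIn j ∘ punchIn k))

  swapRows : Matrix (suc (suc n)) → Matrix (suc (suc n))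
  swapRows A = A (suc zero) ∷ A zero ∷ tail (tail A)

  -- Each term of one expansion is cancelled by a term of the other, so it is the entrywise sum of
  -- the two expansions that `sum-antisym` applies to.
  det-swapRows : (A : Matrix (suc (suc n))) → det A + det (swapRows A) ≈ 0#
  det-swapRows A = begin
    det A + det (swapRows A)
      ≈⟨ +-cong (det-expand A) (det-expand (swapRows A)) ⟩
    sum (λ j → sum (f j)) + sum (λ j → sum (g j))
      ≈⟨ ∑-distrib-+ (λ j → sum (f j)) (λ j → sum (g j)) ⟨
    sum (λ j → sum (f j) + sum (g j))
      ≈⟨ sum-cong-≋ (λ j → sym (∑-distrib-+ (f j) (g j))) ⟩
    sum (λ j → sum (λ k → f j k + g j k))
      ≈⟨ sum-antisym (λ j k → f j k + g j k) (λ {i} {k} i≤k → begin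
           (f (inject₁ i) k + g (inject₁ i) k) + (f (suc k) i + g (suc k) i)
             ≈⟨ solve 4 (λ a b c d → (a :+ b) :+ (c :+ d) := (a :+ d) :+ (b :+ c)) refl
                  (f (inject₁ i) k) (g (inject₁ i) k) (f (suc k) i) (g (suc k) i) ⟩
           (f (inject₁ i) k + g (suc k) i) + (g (inject₁ i) k + f (suc k) i)
             ≈⟨ +-cong (cancel (A zero) (A (suc zero)) i≤k) (cancel (A (suc zero)) (A zero) i≤k) ⟩
           0# + 0#  ≈⟨ +-identityˡ 0# ⟩
           0#       ∎) ⟩
    0# ∎
    where
    cancel = term-cancel (lowerMinor A) (lowerMinor-cong A)
    f = expansion A (A zero) (A (suc zero))
    g = expansion A (A (suc zero)) (A zero)

  -- Swapping equal rows would only show that twice the determinant is zero, which says nothing in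
  -- characteristic two. When the repeated row is the second one, the terms of the double expansion
  -- therefore cancel directly in pairs.
  det-repeatedRow : (A : Matrix (suc n)) (i : Fin n) →
                    (∀ j → A zero j ≈ A (suc i) j) → det A ≈ 0#
  det-repeatedRow {suc n} A zero A₀≈A₁ = trans (det-expand A)
    (sum-antisym (expansion A (A zero) (A (suc zero))) λ {i} {k} i≤k → trans
      (+-congˡ (*-congˡ {x = sgn (suc k)} (*-cong (A₀≈A₁ (suc k))
        (*-congˡ {x = sgn i} (*-congʳ (sym (A₀≈A₁ (punchIn (suc k) i))))))))
      (term-cancel _ (lowerMinor-cong A) (A zero) (A (suc zero)) i≤k))
  -- After swapping the first two rows every minor has a repeated row.
  det-repeatedRow {suc n} A (suc i) A₀≈Aᵢ = begin
    det A                     ≈⟨ +-identityʳ _ ⟨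
    det A + 0#                ≈⟨ +-congˡ (sum-zero (λ j → begin
                                   sgn j * (A (suc zero) j * det (minor j (swapRows A)))
                                     ≈⟨ *-congˡ (*-congˡ (det-repeatedRow (minor j (swapRows A)) i
                                          (λ k → A₀≈Aᵢ (punchIn j k)))) ⟩
                                   sgn j * (A (suc zero) j * 0#)
                                     ≈⟨ *-congˡ (zeroʳ _) ⟩
                                   sgn j * 0#
                                     ≈⟨ zeroʳ _ ⟩
                                   0# ∎)) ⟨
    det A + det (swapRows A)  ≈⟨ det-swapRows A ⟩
    0#                        ∎

  rowOp : Vector Carrier (suc n) → Matrix (suc n) → Matrix (suc n)
  rowOp u A = (λ j → sum (λ k → u k * A k j)) ∷ tail A

  -- By linearity in the top row this is a combination of the determinants of `A k ∷ tail A`. For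
  -- `k` other than zero, row `k` occurs twice there.
  det-rowOp : (u : Vector Carrier (suc n)) (A : Matrix (suc n)) →
              det (rowOp u A) ≈ u zero * det A
  det-rowOp {n} u A = begin
    sum (λ j → sgn j * (sum (λ k → u k * A k j) * m j))
      ≈⟨ sum-cong-≋ (λ j → trans (*-congˡ (*-distribʳ-sum (m j) (λ k → u k * A k j)))
           (*-distribˡ-sum (sgn j) (λ k → (u k * A k j) * m j))) ⟩
    sum (λ j → sum (λ k → sgn j * ((u k * A k j) * m j)))
      ≈⟨ ∑-comm (λ j k → sgn j * ((u k * A k j) * m j)) ⟩
    sum (λ k → sum (λ j → sgn j * ((u k * A k j) * m j)))
      ≈⟨ sum-cong-≋ (λ k → trans
           (sum-cong-≋ (λ j → solve 4 (λ s x y z → s :* ((x :* y) :* z) := x :* (s :* (y :* z)))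
              refl (sgn j) (u k) (A k j) (m j)))
           (sym (*-distribˡ-sum (u k) (λ j → sgn j * (A k j * m j))))) ⟩
    sum (λ k → u k * det (A k ∷ tail A))
      ≈⟨ sum-single {f = λ k → u k * det (A k ∷ tail A)} zero (λ { zero 0≢0 → ⊥-elim (0≢0 ≡.refl)
                            ; (suc i) _ → trans
                                (*-congˡ (det-repeatedRow (A (suc i) ∷ tail A) i (λ _ → refl)))
                                (zeroʳ _) }) ⟩
    u zero * det A ∎
    where
    m : Fin (suc n) → Carrier
    m j = det (minor j A)

  -- The identity matrix and the monoid of square matrices.

  1ₘ-diagonal : (i : Fin n) → 1ₘ i i ≈ 1#
  1ₘ-diagonal zero    = refl
  1ₘ-diagonal (suc i) = 1ₘ-diagonal i

  1ₘ-offDiagonal : {i j : Fin n} → i ≢ j → 1ₘ i j ≈ 0#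
  1ₘ-offDiagonal {i = zero}  {zero}  i≢j = ⊥-elim (i≢j ≡.refl)
  1ₘ-offDiagonal {i = zero}  {suc j} i≢j = refl
  1ₘ-offDiagonal {i = suc i} {zero}  i≢j = refl
  1ₘ-offDiagonal {i = suc i} {suc j} i≢j = 1ₘ-offDiagonal (i≢j ∘ ≡.cong suc)

  1ₘ-punchIn : (i : Fin (suc n)) (j k : Fin n) → 1ₘ (punchIn i j) (punchIn i k) ≡ 1ₘ j k
  1ₘ-punchIn zero    j       k       = ≡.refl
  1ₘ-punchIn (suc i) zero    zero    = ≡.refl
  1ₘ-punchIn (suc i) zero    (suc k) = ≡.refl
  1ₘ-punchIn (suc i) (suc j) zero    = ≡.refl
  1ₘ-punchIn (suc i) (suc j) (suc k) = 1ₘ-punchIn i j k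

  sum-1ₘˡ : (i : Fin n) (f : Vector Carrier n) → sum (λ k → 1ₘ i k * f k) ≈ f i
  sum-1ₘˡ i f = trans
    (sum-single {f = λ k → 1ₘ i k * f k} i
      (λ j j≢i → trans (*-congʳ (1ₘ-offDiagonal (j≢i ∘ ≡.sym))) (zeroˡ _)))
    (trans (*-congʳ (1ₘ-diagonal i)) (*-identityˡ _))

  sum-1ₘʳ : (i : Fin n) (f : Vector Carrier n) → sum (λ k → f k * 1ₘ k i) ≈ f i
  sum-1ₘʳ i f = trans
    (sum-single {f = λ k → f k * 1ₘ k i} i
      (λ j j≢i → trans (*-congˡ (1ₘ-offDiagonal j≢i)) (zeroʳ _)))
    (trans (*-congˡ (1ₘ-diagonal i)) (*-identityʳ _))

  sum-assoc : ∀ {m n} (f : Vector Carrier m) (G : Fin m → Fin n → Carrier) (h : Vector Carrier n) →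
              sum (λ l → sum (λ k → f k * G k l) * h l) ≈ sum (λ k → f k * sum (λ l → G k l * h l))
  sum-assoc f G h = begin
    sum (λ l → sum (λ k → f k * G k l) * h l)
      ≈⟨ sum-cong-≋ (λ l → *-distribʳ-sum (h l) (λ k → f k * G k l)) ⟩
    sum (λ l → sum (λ k → f k * G k l * h l))
      ≈⟨ ∑-comm (λ l k → f k * G k l * h l) ⟩
    sum (λ k → sum (λ l → f k * G k l * h l))
      ≈⟨ sum-cong-≋ (λ k → trans (sum-cong-≋ (λ l → *-assoc (f k) (G k l) (h l)))
           (sym (*-distribˡ-sum (f k) (λ l → G k l * h l)))) ⟩
    sum (λ k → f k * sum (λ l → G k l * h l)) ∎

  *ₘ-monoid : ℕ → Monoid a ℓ
  *ₘ-monoid n = record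
    { isMonoid = record
      { isSemigroup = record
        { isMagma = Magma.isMagma (*ₘ-magma n)
        ; assoc   = λ A B C i j → sum-assoc (A i) B (λ k → C k j)
        }
      ; identity = (λ A i j → sum-1ₘˡ i (λ k → A k j)) , (λ A i j → sum-1ₘʳ j (A i))
      }
    }

  module _ {n : ℕ} where
    open MonoidUnits (*ₘ-monoid n) public using () renaming
      ( Invertible to Invertibleₘ
      ; Invertible-resp to Invertibleₘ-resp
      ; Invertible-∙ to Invertibleₘ-*ₘ
      ; Invertible-cancelˡ to Invertibleₘ-cancelˡ
      )

  -- Invertibility under changes of the top row.

  module _ {n} (u : Vector Carrier (suc n)) (u₀-unit : Invertible (u zero)) where
    private
      u₀⁻¹ = proj₁ u₀-unit

      -- The inverse of `u ∷ tail 1ₘ` has the same shape; its top row is found by solving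
      -- `u zero * v zero ≈ 1#` and `u zero * v (suc j) + u (suc j) ≈ 0#`.
      v : Vector Carrier (suc n)
      v = u₀⁻¹ ∷ (λ i → - (u₀⁻¹ * u (suc i)))

      topRow-inverse : (u v : Vector Carrier (suc n)) → u zero * v zero ≈ 1# →
                       (∀ j → u zero * v (suc j) + u (suc j) ≈ 0#) →
                       ∀ i j → ((u ∷ tail 1ₘ) *ₘ (v ∷ tail 1ₘ)) i j ≈ 1ₘ i j
      topRow-inverse u v uv₀ uv zero zero = begin
        u zero * v zero + sum (λ k → u (suc k) * 0#)
          ≈⟨ +-cong uv₀ (sum-zero (λ k → zeroʳ (u (suc k)))) ⟩
        1# + 0#  ≈⟨ +-identityʳ 1# ⟩
        1#       ∎
      topRow-inverse u v uv₀ uv zero (suc j) = trans (+-congˡ (sum-1ₘʳ j (u ∘ suc))) (uv j)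
      topRow-inverse u v uv₀ uv (suc i) j    = sum-1ₘˡ (suc i) (λ k → (v ∷ tail 1ₘ) k j)

    topRow-invertible : Invertibleₘ (u ∷ tail 1ₘ)
    topRow-invertible =
        (v ∷ tail 1ₘ)
      , topRow-inverse v u (proj₁ (proj₂ u₀-unit)) (λ j → -‿inverseʳ _)
      , topRow-inverse u v (proj₂ (proj₂ u₀-unit)) (λ j → begin
          u zero * - (u₀⁻¹ * u (suc j)) + u (suc j)
            ≈⟨ +-congʳ (-‿distribʳ-* (u zero) _) ⟨
          - (u zero * (u₀⁻¹ * u (suc j))) + u (suc j)
            ≈⟨ +-congʳ (-‿cong (trans (sym (*-assoc _ _ _))
                 (trans (*-congʳ (proj₂ (proj₂ u₀-unit))) (*-identityˡ _)))) ⟩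
          - u (suc j) + u (suc j)
            ≈⟨ -‿inverseˡ _ ⟩
          0# ∎)

    private
      -- Links the form of the operation suited to `det` with the product form suited to
      -- invertibility.
      topRow-*ₘ : (A : Matrix (suc n)) → ∀ i j → ((u ∷ tail 1ₘ) *ₘ A) i j ≈ rowOp u A i j
      topRow-*ₘ A zero    j = refl
      topRow-*ₘ A (suc i) j = sum-1ₘˡ (suc i) (λ k → A k j)

    rowOp-invertible⁺ : (A : Matrix (suc n)) → Invertibleₘ A → Invertibleₘ (rowOp u A)
    rowOp-invertible⁺ A A-inv =
      Invertibleₘ-resp (topRow-*ₘ A) (Invertibleₘ-*ₘ {x = u ∷ tail 1ₘ} {y = A} topRow-invertible A-inv)

    rowOp-invertible⁻ : (A : Matrix (suc n)) → Invertibleₘ (rowOp u A) → Invertibleₘ A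
    rowOp-invertible⁻ A A-inv = Invertibleₘ-cancelˡ {x = u ∷ tail 1ₘ} {y = A} topRow-invertible
      (Invertibleₘ-resp (λ i j → sym (topRow-*ₘ A i j)) A-inv)

  det-unitTopRow : (j : Fin (suc n)) (A : Matrix (suc n)) → (∀ k → A zero k ≈ 1ₘ j k) →
                   det A ≈ sgn j * det (minor j A)
  det-unitTopRow j A A₀≈eⱼ = trans
    (sum-single {f = λ k → sgn k * (A zero k * det (minor k A))} j λ k k≢j →
      trans (*-congˡ (trans (*-congʳ (trans (A₀≈eⱼ k) (1ₘ-offDiagonal (k≢j ∘ ≡.sym)))) (zeroˡ _))) (zeroʳ _))
    (*-congˡ (trans (*-congʳ (trans (A₀≈eⱼ j) (1ₘ-diagonal j))) (*-identityˡ _)))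

  -- The inverse is `N` without row `j` and column zero. Each product loses one summand by the
  -- deletion, and that summand is zero: in `N A` because the top row of `A` vanishes away from `j`,
  -- in `A N` because row `j` of `N` equals the top row of `A N`, hence of the identity.
  minor-invertible : (j : Fin (suc n)) (A : Matrix (suc n)) → (∀ k → A zero k ≈ 1ₘ j k) →
                     Invertibleₘ A → Invertibleₘ (minor j A)
  minor-invertible j A A₀≈eⱼ (N , NA , AN) =
      (λ i k → N (punchIn j i) (suc k))
    , (λ i k → begin
         sum (λ l → N (punchIn j i) (suc l) * A (suc l) (punchIn j k))
           ≈⟨ +-identityˡ _ ⟨
         0# + sum (λ l → N (punchIn j i) (suc l) * A (suc l) (punchIn j k))
           ≈⟨ +-congʳ (trans (*-congˡ (trans (A₀≈eⱼ (punchIn j k))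
                (1ₘ-offDiagonal (Fin.punchInᵢ≢i j k ∘ ≡.sym)))) (zeroʳ _)) ⟨
         (N *ₘ A) (punchIn j i) (punchIn j k)
           ≈⟨ NA (punchIn j i) (punchIn j k) ⟩
         1ₘ (punchIn j i) (punchIn j k)
           ≡⟨ 1ₘ-punchIn j i k ⟩
         1ₘ i k ∎)
    , (λ i k → begin
         sum (λ l → A (suc i) (punchIn j l) * N (punchIn j l) (suc k))
           ≈⟨ +-identityˡ _ ⟨
         0# + sum (λ l → A (suc i) (punchIn j l) * N (punchIn j l) (suc k))
           ≈⟨ +-congʳ (trans (*-congˡ (Nⱼ≈0 k)) (zeroʳ (A (suc i) j))) ⟨
         A (suc i) j * N j (suc k) + sum (λ l → A (suc i) (punchIn j l) * N (punchIn j l) (suc k))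
           ≈⟨ sum-remove (λ l → A (suc i) l * N l (suc k)) ⟨
         (A *ₘ N) (suc i) (suc k)
           ≈⟨ AN (suc i) (suc k) ⟩
         1ₘ i k ∎)
    where
    Nⱼ≈0 : ∀ k → N j (suc k) ≈ 0#
    Nⱼ≈0 k = trans (sym (sum-1ₘˡ j (λ l → N l (suc k))))
      (trans (sum-cong-≋ (λ l → *-congʳ {x = N l (suc k)} (sym (A₀≈eⱼ l)))) (AN zero (suc k)))

  -- Block upper triangular matrices.

  module _ (A : Matrix (suc n)) (A₁₀≈0 : ∀ i → A (suc i) zero ≈ 0#) where

    -- The first column of `N A` collapses to `N i zero * A zero zero`. Hence the corner is a unit
    -- and `N` is block upper triangular as well, so the lower right blocks of `N` and `A` are
    -- inverse to each other.
    upper-invertible⁻ : Invertibleₘ A → Invertible (A zero zero) × Invertibleₘ (minor zero A)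
    upper-invertible⁻ (N , NA , AN) =
        (N zero zero , N₀A₀ , trans (*-comm _ _) N₀A₀)
      , (λ i j → N (suc i) (suc j))
      , (λ i j → trans (sym (trans (+-congʳ (trans (*-congʳ (N₁₀≈0 i)) (zeroˡ _))) (+-identityˡ _)))
                   (NA (suc i) (suc j)))
      , (λ i j → trans (sym (trans (+-congʳ (trans (*-congʳ (A₁₀≈0 i)) (zeroˡ _))) (+-identityˡ _)))
                   (AN (suc i) (suc j)))
      where
      NA-column : ∀ i → N i zero * A zero zero ≈ 1ₘ i zero
      NA-column i = trans
        (sym (trans (+-congˡ (sum-zero (λ k → trans (*-congˡ (A₁₀≈0 k)) (zeroʳ (N i (suc k)))))) (+-identityʳ _)))
        (NA i zero)

      N₀A₀ = NA-column zero

      N₁₀≈0 : ∀ i → N (suc i) zero ≈ 0#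
      N₁₀≈0 i = begin
        N (suc i) zero                                  ≈⟨ *-identityʳ _ ⟨
        N (suc i) zero * 1#                             ≈⟨ *-congˡ (trans (*-comm _ _) N₀A₀) ⟨
        N (suc i) zero * (A zero zero * N zero zero)    ≈⟨ *-assoc _ _ _ ⟨
        N (suc i) zero * A zero zero * N zero zero      ≈⟨ *-congʳ (NA-column (suc i)) ⟩
        0# * N zero zero                                ≈⟨ zeroˡ _ ⟩
        0#                                              ∎

    module _ (A₀₀-unit : Invertible (A zero zero)) (minor-inv : Invertibleₘ (minor zero A)) where
      private
        H = proj₁ minor-inv

        -- With H the inverse of the minor, A is a row operation on 1 ⊕ minor.
        D : Matrix (suc n)
        D = 1ₘ zero ∷ tail A

        u : Vector Carrier (suc n)
        u = A zero zero ∷ (λ i → sum (λ k → A zero (suc k) * H k i))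

        D-invertible : Invertibleₘ D
        D-invertible =
            E
          , (λ { zero j → sum-1ₘˡ zero (λ k → D k j)
               ; (suc i) zero → trans
                   (+-cong (zeroˡ _) (sum-zero (λ k → trans (*-congˡ (A₁₀≈0 k)) (zeroʳ (H i k)))))
                   (+-identityˡ 0#)
               ; (suc i) (suc j) → trans (+-congʳ (zeroˡ _))
                   (trans (+-identityˡ _) (proj₁ (proj₂ minor-inv) i j)) })
          , (λ { zero j → sum-1ₘˡ zero (λ k → E k j)
               ; (suc i) zero → trans
                   (+-cong (trans (*-congʳ (A₁₀≈0 i)) (zeroˡ _)) (sum-zero (λ k → zeroʳ (A (suc i) (suc k)))))
                   (+-identityˡ 0#)
               ; (suc i) (suc j) → trans (+-congʳ (zeroʳ _))
                   (trans (+-identityˡ _) (proj₂ (proj₂ minor-inv) i j)) })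
          where
          E : Matrix (suc n)
          E = 1ₘ zero ∷ (λ i → 0# ∷ H i)

        rowOp-D : ∀ i j → rowOp u D i j ≈ A i j
        rowOp-D zero zero = begin
          A zero zero * 1# + sum (λ i → u (suc i) * A (suc i) zero)
            ≈⟨ +-cong (*-identityʳ _) (sum-zero (λ i → trans (*-congˡ (A₁₀≈0 i)) (zeroʳ (u (suc i))))) ⟩
          A zero zero + 0#
            ≈⟨ +-identityʳ _ ⟩
          A zero zero ∎
        rowOp-D zero (suc j) = begin
          A zero zero * 0# + sum (λ i → u (suc i) * A (suc i) (suc j))
            ≈⟨ trans (+-congʳ (zeroʳ _)) (+-identityˡ _) ⟩
          sum (λ i → u (suc i) * A (suc i) (suc j))
            ≈⟨ sum-assoc (A zero ∘ suc) H (λ i → A (suc i) (suc j)) ⟩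
          sum (λ k → A zero (suc k) * sum (λ i → H k i * A (suc i) (suc j)))
            ≈⟨ sum-cong-≋ (λ k → *-congˡ (proj₁ (proj₂ minor-inv) k j)) ⟩
          sum (λ k → A zero (suc k) * 1ₘ k j)
            ≈⟨ sum-1ₘʳ j (A zero ∘ suc) ⟩
          A zero (suc j) ∎
        rowOp-D (suc i) j = refl

      upper-invertible⁺ : Invertibleₘ A
      upper-invertible⁺ = Invertibleₘ-resp rowOp-D (rowOp-invertible⁺ u A₀₀-unit D D-invertible)

      det-upper : det A ≈ A zero zero * det (minor zero A)
      det-upper = begin
        det A                                    ≈⟨ det-cong rowOp-D ⟨
        det (rowOp u D)                          ≈⟨ det-rowOp u D ⟩
        A zero zero * det D                      ≈⟨ *-congˡ (det-unitTopRow zero D (λ _ → refl)) ⟩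
        A zero zero * (1# * det (minor zero A))  ≈⟨ *-congˡ (*-identityˡ _) ⟩
        A zero zero * det (minor zero A)         ∎

  sgn-invertible : (j : Fin n) → Invertible (sgn j)
  sgn-invertible zero    = 1# , *-identityˡ 1# , *-identityˡ 1#
  sgn-invertible (suc j) = Invertible-∙ (- 1# , -1*-1 , -1*-1) (sgn-invertible j)
    where
    -1*-1 : - 1# * - 1# ≈ 1#
    -1*-1 = begin
      - 1# * - 1#    ≈⟨ -‿distribˡ-* 1# (- 1#) ⟨
      - (1# * - 1#)  ≈⟨ -‿cong (*-identityˡ _) ⟩
      - (- 1#)       ≈⟨ -‿involutive 1# ⟩
      1#             ∎

  -- Determinants of invertible matrices when every element is a unit or zero.

  module _ (unit-or-zero : ∀ x → Invertible x ⊎ x ≈ 0#) where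

    someUnit : (f : Vector Carrier n) → (∃ λ i → Invertible (f i)) ⊎ (∀ i → f i ≈ 0#)
    someUnit {zero}  f = inj₂ λ ()
    someUnit {suc n} f with unit-or-zero (f zero) | someUnit (f ∘ suc)
    ... | inj₁ f₀-unit | _                   = inj₁ (zero , f₀-unit)
    ... | inj₂ _       | inj₁ (i , fᵢ-unit)  = inj₁ (suc i , fᵢ-unit)
    ... | inj₂ f₀≈0    | inj₂ f≈0            = inj₂ λ { zero → f₀≈0 ; (suc i) → f≈0 i }

    -- If N is the inverse of A and N j 0 is a unit, replacing the top row of A by
    -- row j of N A = 1 multiplies det A by N j 0 and leaves a single cofactor.
    det-invertible : (A : Matrix n) → Invertibleₘ A → Invertible (det A)
    det-invertible {zero}  A _ = 1# , *-identityˡ 1# , *-identityˡ 1#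
    det-invertible {suc n} A A-inv@(N , NA , AN) with someUnit (λ j → N j zero)
    ... | inj₁ (j , Nⱼ₀-unit) = Invertible-cancelˡ Nⱼ₀-unit (Invertible-resp
      (trans (sym (det-unitTopRow j (rowOp (N j) A) (NA j))) (det-rowOp (N j) A))
      (Invertible-∙ (sgn-invertible j) (det-invertible (minor j A)
        (minor-invertible j (rowOp (N j) A) (NA j) (rowOp-invertible⁺ (N j) Nⱼ₀-unit A A-inv)))))
    -- If the first column of `N` is zero, the corner of `A N` is both `0#` and `1#`; the ring
    -- collapses and `0#` inverts everything.
    ... | inj₂ N₀≈0 = 0# , trans (zeroˡ _) 0≈1 , trans (zeroʳ _) 0≈1
      where
      0≈1 : 0# ≈ 1#
      0≈1 = trans (sym (sum-zero (λ k → trans (*-congˡ (N₀≈0 k)) (zeroʳ (A zero k))))) (AN zero zero)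

-- Sums over finite setoids.

module FiniteSums (K : CommutativeRing a ℓ) where
  open CommutativeRing K hiding (zero)
  open RawSemiringDefinitions (Semiring.rawSemiring semiring) using () renaming (_×_ to _×ᴷ_)
  open SemiringMult semiring using (×-assoc-*; ×-congʳ)
  open SemiringSum semiring
    using (sum; sum-cong-≋; sum-replicate; ∑-comm; sum-permute; *-distribˡ-sum; *-distribʳ-sum)
  open Determinants K using (sum-zero; sum-single)
  open SetoidReasoning setoid

  private
    variable
      b p : Level
      k m : ℕ

  sum-↑ : ∀ m (f : Vector Carrier (m ℕ.+ n)) → sum f ≈ sum (λ i → f (i Fin.↑ˡ n)) + sum (λ j → f (m Fin.↑ʳ j))
  sum-↑ zero    f = sym (+-identityˡ _)
  sum-↑ (suc m) f = trans (+-congˡ (sum-↑ m (f ∘ suc))) (sym (+-assoc _ _ _))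

  sum-combine : ∀ m (f : Vector Carrier (m ℕ.* n)) →
                sum f ≈ sum (λ (i : Fin m) → sum (λ (j : Fin n) → f (Fin.combine i j)))
  sum-combine     zero    f = refl
  sum-combine {n} (suc m) f = trans (sum-↑ n f) (+-congˡ (sum-combine m (f ∘ (n Fin.↑ʳ_))))

  -- Summing over `Fin m` instead of a list turns a change of variables into invariance of `sum`
  -- under permutations.
  sumOver : {S : Setoid b p} → Finite S m → (Setoid.Carrier S → Carrier) → Carrier
  sumOver fin f = sum (f ∘ Inverse.from fin)

  module _ {S : Setoid b p} (fin : Finite S m) where
    private module S = Setoid S
    open Inverse fin using (to; from; strictlyInverseˡ; strictlyInverseʳ; to-cong)

    sumOver-cong : {f g : S.Carrier → Carrier} → (∀ x → f x ≈ g x) → sumOver fin f ≈ sumOver fin g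
    sumOver-cong f≈g = sum-cong-≋ (λ i → f≈g (from i))

    sumOver-zero : {f : S.Carrier → Carrier} → (∀ x → f x ≈ 0#) → sumOver fin f ≈ 0#
    sumOver-zero f≈0 = sum-zero (λ i → f≈0 (from i))

    sumOver-single : {f : S.Carrier → Carrier} → Congruent S._≈_ _≈_ f → (s : S.Carrier) →
                     (∀ x → ¬ x S.≈ s → f x ≈ 0#) → sumOver fin f ≈ f s
    sumOver-single {f} f-cong s f≈0 = trans
      (sum-single {f = f ∘ from} (to s) λ j j≢s → f≈0 (from j) λ xj≈s →
        j≢s (≡.trans (≡.sym (strictlyInverseˡ j)) (to-cong xj≈s)))
      (f-cong (strictlyInverseʳ s))

    sumOver-const : ∀ x → sumOver fin (λ _ → x) ≈ m ×ᴷ 1# * x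
    sumOver-const x = begin
      sum {m} (λ _ → x)  ≈⟨ sum-replicate m ⟩
      m ×ᴷ x             ≈⟨ ×-congʳ m (*-identityˡ x) ⟨
      m ×ᴷ (1# * x)      ≈⟨ ×-assoc-* m 1# x ⟨
      m ×ᴷ 1# * x        ∎

    *-distribˡ-sumOver : ∀ x (f : S.Carrier → Carrier) → x * sumOver fin f ≈ sumOver fin (λ y → x * f y)
    *-distribˡ-sumOver x f = *-distribˡ-sum x (f ∘ from)

    *-distribʳ-sumOver : ∀ x (f : S.Carrier → Carrier) → sumOver fin f * x ≈ sumOver fin (λ y → f y * x)
    *-distribʳ-sumOver x f = *-distribʳ-sum x (f ∘ from)

  module _ {b′ p′} {S : Setoid b p} {T : Setoid b′ p′} (finS : Finite S m) (finT : Finite T n) where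
    private
      module S = Setoid S
      module T = Setoid T

    sumOver-comm : (f : S.Carrier → T.Carrier → Carrier) →
                   sumOver finS (λ x → sumOver finT (f x)) ≈ sumOver finT (λ y → sumOver finS (λ x → f x y))
    sumOver-comm f = ∑-comm (λ i j → f (Inverse.from finS i) (Inverse.from finT j))

    sumOver-reindex : (φ : Inverse S T) {f : T.Carrier → Carrier} → Congruent T._≈_ _≈_ f →
                      sumOver finT f ≈ sumOver finS (f ∘ Inverse.to φ)
    sumOver-reindex φ {f} f-cong = trans
      (sum-permute (f ∘ Inverse.from finT) (inverse (symmetry finS) (inverse φ finT)))
      (sum-cong-≋ (λ i → f-cong (Inverse.strictlyInverseʳ finT (Inverse.to φ (Inverse.from finS i)))))

  module _ {S : Setoid b p} (fin : Finite S m) where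
    private
      module S = Setoid S
      module V n = Setoid (VectorSetoid S n)

    sumOver-[] : (f : Vector S.Carrier 0 → Carrier) →
                 Congruent (V._≈_ 0) _≈_ f → sumOver (finiteVectors fin 0) f ≈ f []
    sumOver-[] f f-cong = trans (+-identityʳ _) (f-cong λ ())

    -- `finiteVectors` numbers a vector by `combine` of the index of its head with the number of its
    -- tail, so splitting the index splits off the head.
    sumOver-∷ : (f : Vector S.Carrier (suc n) → Carrier) → Congruent (V._≈_ (suc n)) _≈_ f →
                sumOver (finiteVectors fin (suc n)) f ≈
                sumOver fin (λ x → sumOver (finiteVectors fin n) (λ v → f (x ∷ v)))
    sumOver-∷ {n} f f-cong = trans (sum-combine m _)
      (sum-cong-≋ λ i → sum-cong-≋ λ (j : Fin (m ℕ.^ n)) → f-cong λ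
        { zero    → S.reflexive (≡.cong (λ ij → Inverse.from fin (proj₁ ij)) (Fin.remQuot-combine i j))
        ; (suc l) → S.reflexive (≡.cong (λ ij → Inverse.from fin (Fin.finToFun (proj₂ ij) l)) (Fin.remQuot-combine i j))
        })

  module _ {S : Setoid b p} (fin : Finite S m) where
    private
      module S = Setoid S

    -- Families of rows are enumerated row by row, but the case distinction is on their first
    -- column. By induction on the number of rows, the sum over the tail of the first row is moved
    -- past the sum over the rest of the column.
    sumOver-columns : (f : Vector (Vector S.Carrier (suc n)) k → Carrier) →
      Congruent (Setoid._≈_ (VectorSetoid (VectorSetoid S (suc n)) k)) _≈_ f →
      sumOver (finiteVectors (finiteVectors fin (suc n)) k) f ≈
      sumOver (finiteVectors fin k) (λ c → sumOver (finiteVectors (finiteVectors fin n) k)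
        (λ B → f (λ i → c i ∷ B i)))
    sumOver-columns {n} {zero} f f-cong = begin
      sumOver (finiteVectors (finiteVectors fin (suc n)) 0) f
        ≈⟨ sumOver-[] (finiteVectors fin (suc n)) f f-cong ⟩
      f []
        ≈⟨ f-cong (λ ()) ⟩
      f (λ i → c₀ i ∷ B₀ i)
        ≈⟨ sumOver-[] (finiteVectors fin n) (λ B → f (λ i → c₀ i ∷ B i)) (λ _ → f-cong λ ()) ⟨
      sumOver (finiteVectors (finiteVectors fin n) 0) (λ B → f (λ i → c₀ i ∷ B i))
        ≈⟨ sumOver-[] fin (λ c → sumOver (finiteVectors (finiteVectors fin n) 0) (λ B → f (λ i → c i ∷ B i)))
             (λ {c} {c′} _ → sumOver-cong (finiteVectors (finiteVectors fin n) 0) (λ B →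
               f-cong {λ i → c i ∷ B i} {λ i → c′ i ∷ B i} λ ())) ⟨
      sumOver (finiteVectors fin 0) (λ c → sumOver (finiteVectors (finiteVectors fin n) 0)
        (λ B → f (λ i → c i ∷ B i))) ∎
      where
      c₀ : Vector S.Carrier 0
      c₀ = []
      B₀ : Vector (Vector S.Carrier n) 0
      B₀ = []
    sumOver-columns {n} {suc k} f f-cong = begin
      sumOver (finiteVectors finRow (suc k)) f
        ≈⟨ sumOver-∷ finRow f f-cong ⟩
      sumOver finRow (λ r → sumOver (finiteVectors finRow k) (λ B → f (r ∷ B)))
        ≈⟨ sumOver-∷ fin (λ r → sumOver (finiteVectors finRow k) (λ B → f (r ∷ B)))
             (λ {r} {r′} r≈r′ → sumOver-cong (finiteVectors finRow k) (λ B →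
               f-cong {r ∷ B} {r′ ∷ B} (λ { zero → r≈r′ ; (suc _) _ → S.refl }))) ⟩
      sumOver fin (λ x → sumOver finV (λ r → sumOver (finiteVectors finRow k) (λ B → f ((x ∷ r) ∷ B))))
        ≈⟨ sumOver-cong fin (λ x → sumOver-cong finV (λ r →
             sumOver-columns (λ B → f ((x ∷ r) ∷ B)) (λ B≈B′ →
               f-cong (λ { zero _ → S.refl ; (suc i) → B≈B′ i })))) ⟩
      sumOver fin (λ x → sumOver finV (λ r → sumOver finC (λ c → sumOver finB (λ B →
        f ((x ∷ r) ∷ (λ i → c i ∷ B i))))))
        ≈⟨ sumOver-cong fin (λ x → sumOver-comm finV finC (λ r c → sumOver finB (λ B →
             f ((x ∷ r) ∷ (λ i → c i ∷ B i))))) ⟩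
      sumOver fin (λ x → sumOver finC (λ c → sumOver finV (λ r → sumOver finB (λ B →
        f ((x ∷ r) ∷ (λ i → c i ∷ B i))))))
        ≈⟨ sumOver-cong fin (λ x → sumOver-cong finC (λ c → sumOver-cong finV (λ r → sumOver-cong finB (λ B →
             f-cong {(x ∷ r) ∷ (λ i → c i ∷ B i)} {λ i → (x ∷ c) i ∷ (r ∷ B) i}
               (λ { zero zero → S.refl ; zero (suc _) → S.refl
                  ; (suc _) zero → S.refl ; (suc _) (suc _) → S.refl }))))) ⟩
      sumOver fin (λ x → sumOver finC (λ c → sumOver finV (λ r → sumOver finB (λ B → F (x ∷ c) (r ∷ B)))))
        ≈⟨ sumOver-cong fin (λ x → sumOver-cong finC (λ c → sumOver-∷ finV (F (x ∷ c)) (F-congʳ (x ∷ c)))) ⟨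
      sumOver fin (λ x → sumOver finC (λ c → sumOver (finiteVectors finV (suc k)) (F (x ∷ c))))
        ≈⟨ sumOver-∷ fin (λ c → sumOver (finiteVectors finV (suc k)) (F c))
             (λ {c} {c′} c≈c′ → sumOver-cong (finiteVectors finV (suc k)) (λ B →
               f-cong {λ i → c i ∷ B i} {λ i → c′ i ∷ B i}
                 (λ { i zero → c≈c′ i ; i (suc _) → S.refl }))) ⟨
      sumOver (finiteVectors fin (suc k)) (λ c → sumOver (finiteVectors finV (suc k)) (F c)) ∎
      where
      finRow = finiteVectors fin (suc n)
      finV   = finiteVectors fin n
      finC   = finiteVectors fin k
      finB   = finiteVectors finV k

      F : Vector S.Carrier (suc k) → Vector (Vector S.Carrier n) (suc k) → Carrier
      F c B = f (λ i → c i ∷ B i)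

      F-congʳ : ∀ c → Congruent (Setoid._≈_ (VectorSetoid (VectorSetoid S n) (suc k))) _≈_ (F c)
      F-congʳ c B≈B′ = f-cong (λ { i zero → S.refl ; i (suc j) → B≈B′ i j })

  -- Extension by zero of a summand that may use the proof of `P`, as `χ` uses the inverse packed
  -- into a unit.
  restrict : {P : Set p} → Dec P → (P → Carrier) → Carrier
  restrict (yes p) f = f p
  restrict (no _)  f = 0#

  private
    variable
      P Q R : Set p

  -- The decisions are made independently and may return unrelated witnesses, so the equation is
  -- asked for all of them.
  restrict-* : {P? : Dec P} {Q? : Dec Q} {R? : Dec R} {f : P → Carrier} {g : Q → Carrier} {h : R → Carrier} →
               (P → Q × R) → (Q → R → P) → (∀ p q r → f p ≈ g q * h r) →
               restrict P? f ≈ restrict Q? g * restrict R? h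
  restrict-* {P? = yes p} {yes q} {yes r} _ _ eq  = eq p q r
  restrict-* {P? = yes p} {no ¬q} {_} to _ _      = contradiction (proj₁ (to p)) ¬q
  restrict-* {P? = yes p} {yes q} {no ¬r} to _ _  = contradiction (proj₂ (to p)) ¬r
  restrict-* {P? = no ¬p} {yes q} {yes r} _ from _ = contradiction (from q r) ¬p
  restrict-* {P? = no ¬p} {no ¬q} {_} _ _ _       = sym (zeroˡ _)
  restrict-* {P? = no ¬p} {yes q} {no ¬r} _ _ _   = sym (zeroʳ _)

  restrict-scale : {P? : Dec P} {Q? : Dec Q} {f : P → Carrier} {g : Q → Carrier} (x : Carrier) →
                   (P → Q) → (Q → P) → (∀ p q → f p ≈ x * g q) → restrict P? f ≈ x * restrict Q? g
  restrict-scale {P? = P?} {Q?} x to from eq = restrict-* {P? = P?} {yes tt} {Q?} {g = λ _ → x}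
    (λ p → tt , to p) (λ _ → from) (λ p _ q → eq p q)

  restrict-cong : {P? : Dec P} {Q? : Dec Q} {f : P → Carrier} {g : Q → Carrier} →
                  (P → Q) → (Q → P) → (∀ p q → f p ≈ g q) → restrict P? f ≈ restrict Q? g
  restrict-cong {P? = P?} {Q?} to from eq = trans
    (restrict-scale {P? = P?} {Q?} 1# to from (λ p q → trans (eq p q) (sym (*-identityˡ _))))
    (*-identityˡ _)

  listSum : {X : Set b} → List X → (X → Carrier) → Carrier
  listSum xs f = List.foldr _+_ 0# (List.map f xs)

  -- The list `allFin n` is `tabulate id`; an arbitrary `x` in place of `id` makes the induction go
  -- through, as the tail tabulates `x ∘ suc`.
  listSum-mapMaybe : ∀ {b′ b″} {X : Set b} {Y : Set b′} {Z : Set b″}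
    (f : Z → Carrier) (h : Y → Maybe Z) (e : X → Y) (x : Fin n → X) →
    listSum (List.mapMaybe h (List.map e (List.tabulate x))) f ≈ sum (λ i → maybe f 0# (h (e (x i))))
  listSum-mapMaybe {n = zero}  f h e x = refl
  listSum-mapMaybe {n = suc n} f h e x with h (e (x zero))
  ... | just y  = +-congˡ (listSum-mapMaybe f h e (x ∘ suc))
  ... | nothing = trans (listSum-mapMaybe f h e (x ∘ suc)) (sym (+-identityˡ _))

  module _ (M : Magma b p) (ε : Magma.Carrier M) (fin : Finite (Magma.setoid M) m) where
    open Invertibles M ε

    listSum-units : (f : Unit → Carrier) →
      listSum (units fin) f ≈ sumOver fin (λ x → restrict (invertible? fin x) (λ x⁻¹ → f (x , x⁻¹)))
    listSum-units f = trans
      (listSum-mapMaybe f (λ x → Maybe.map (x ,_) (dec⇒maybe (invertible? fin x))) (Inverse.from fin) id)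
      (sumOver-cong fin λ x → lemma x (invertible? fin x))
      where
      lemma : ∀ x (x-inv? : Dec _) →
              maybe f 0# (Maybe.map (x ,_) (dec⇒maybe x-inv?)) ≈ restrict x-inv? (λ x⁻¹ → f (x , x⁻¹))
      lemma x (yes _) = refl
      lemma x (no _)  = refl

  listSum-ones : {X : Set b} (xs : List X) {f : X → Carrier} → (∀ x → f x ≈ 1#) →
                 listSum xs f ≈ List.length xs ×ᴷ 1#
  listSum-ones List.[]       f≈1 = refl
  listSum-ones (x List.∷ xs) f≈1 = +-cong (f≈1 x) (listSum-ones xs f≈1)

-- Character sums over the general linear group.

module GaussSumsOverGL {c ℓ₁ ℓ₂ c′ ℓ₁′ ℓ₂′ : Level}
  (F : HeytingField c ℓ₁ ℓ₂) {q : ℕ} (fin : Finite (setoidOf F) q)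
  (K : HeytingField c′ ℓ₁′ ℓ₂′)
  (χ : Character (F ˣ) K) (ψ : Character (F ⁺) K)
  where

  private
    module F = CommutativeRing (ringOf F)
    module χ = GroupHomomorphism χ
    module ψ = GroupHomomorphism ψ
    module HF = HeytingField F
    module HK = HeytingField K
  open CommutativeRing (ringOf K) hiding (zero)
  open CharacterSums F fin K χ ψ using (fromℕ; χ₀; gaussSum; sumGL; orderGL; _^_)
  open Matrices (ringOf F)
  open Determinants (ringOf F)
  open MonoidUnits F.*-monoid
  open FiniteSums (ringOf K)
  open Invertibles F.*-magma F.1# using (Unit; invertible?)
  open SemiringSum F.semiring using (sum; sum-cong-≋; *-distribˡ-sum)
  open SemiringMult semiring using (×1-homo-*)
  open RingSolver commutativeSemiring using (solve; _:=_; _:*_)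
  open SetoidReasoning setoid

  -- By tightness it suffices to refute that `x` is apart from zero. If it were, it would be
  -- invertible, and cancelling it would make every `f i` equal to `1#`.
  vanishing : ∀ {i} {I : Set i} (f : I → Carrier) (x : Carrier) →
              (∀ i → f i * x ≈ x) → ¬ (∀ i → f i ≈ 1#) → x ≈ 0#
  vanishing f x fx≈x f≉1 = proj₁ (HK.tight x 0#) λ x#0 → f≉1 λ i →
    let y , _ , xy = HK.#⇒invertible x#0
        xy≈1 : x * y ≈ 1#
        -- `#⇒invertible` inverts the difference of `x` and `0#`, not `x` itself.
        xy≈1 = trans (*-congʳ (trans (sym (+-identityʳ x)) (+-congˡ (sym (RingProperties.-0#≈0# ring))))) xy
    in begin
      f i              ≈⟨ *-identityʳ _ ⟨
      f i * 1#         ≈⟨ *-congˡ xy≈1 ⟨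
      f i * (x * y)    ≈⟨ *-assoc _ _ _ ⟨
      f i * x * y      ≈⟨ *-congʳ (fx≈x i) ⟩
      x * y            ≈⟨ xy≈1 ⟩
      1#               ∎

  -- Finite search decides invertibility; an element that is no unit cannot be apart from zero,
  -- hence is zero by tightness.
  unit-or-zero : ∀ x → Invertible x ⊎ x F.≈ F.0#
  unit-or-zero x with invertible? fin x
  ... | yes x-unit = inj₁ x-unit
  ... | no ¬x-unit = inj₂ (proj₁ (HF.tight x F.0#) λ x#0 →
    ¬x-unit (Invertible-resp
      (F.trans (F.+-congˡ (RingProperties.-0#≈0# F.ring)) (F.+-identityʳ x)) (HF.#⇒invertible x#0)))

  χ₁ : Unit → Carrier
  χ₁ u = proj₁ χ.⟦ u ⟧

  ψ₁ : F.Carrier → Carrier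
  ψ₁ x = proj₁ ψ.⟦ x ⟧

  ψ₁-cong : ∀ {x y} → x F.≈ y → ψ₁ x ≈ ψ₁ y
  ψ₁-cong = ψ.⟦⟧-cong

  χ₁-cong : ∀ {u v} → proj₁ u F.≈ proj₁ v → χ₁ u ≈ χ₁ v
  χ₁-cong {u} {v} = χ.⟦⟧-cong {u} {v}

  χ₀-restrict : ∀ x → χ₀ x ≡ restrict (invertible? fin x) (λ x-unit → χ₁ (x , x-unit))
  χ₀-restrict x with invertible? fin x
  ... | yes _ = ≡.refl
  ... | no  _ = ≡.refl

  -- Multiplication by a unit neither creates nor destroys units, so for a non-unit `x` both sides
  -- are zero.
  χ₀-* : (u : Unit) (x : F.Carrier) → χ₀ (proj₁ u F.* x) ≈ χ₁ u * χ₀ x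
  χ₀-* u@(y , y-unit) x = begin
    χ₀ (y F.* x)
      ≡⟨ χ₀-restrict (y F.* x) ⟩
    restrict (invertible? fin (y F.* x)) _
      ≈⟨ restrict-scale {P? = invertible? fin (y F.* x)} {invertible? fin x} (χ₁ u)
           (Invertible-cancelˡ y-unit) (Invertible-∙ y-unit)
           (λ yx-unit x-unit → trans
             (χ₁-cong {y F.* x , yx-unit} {y F.* x , Invertible-∙ y-unit x-unit} F.refl)
             (χ.homo u (x , x-unit))) ⟩
    χ₁ u * restrict (invertible? fin x) _
      ≡⟨ ≡.cong (χ₁ u *_) (χ₀-restrict x) ⟨
    χ₁ u * χ₀ x ∎

  χ₀-unit : (u : Unit) → χ₀ (proj₁ u) ≈ χ₁ u
  χ₀-unit u@(x , x-unit) with invertible? fin x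
  ... | yes x-unit′ = χ₁-cong {x , x-unit′} {u} F.refl
  ... | no ¬x-unit  = contradiction x-unit ¬x-unit

  χ₀-cong : ∀ {x y} → x F.≈ y → χ₀ x ≈ χ₀ y
  χ₀-cong {x} {y} x≈y = begin
    χ₀ x                              ≡⟨ χ₀-restrict x ⟩
    restrict (invertible? fin x) _    ≈⟨ restrict-cong {P? = invertible? fin x} {invertible? fin y}
                                           (Invertible-resp x≈y) (Invertible-resp (F.sym x≈y))
                                           (λ x-unit y-unit → χ₁-cong {x , x-unit} {y , y-unit} x≈y) ⟩
    restrict (invertible? fin y) _    ≡⟨ χ₀-restrict y ⟨
    χ₀ y                              ∎

  invertibleₘ? : (A : Matrix n) → Dec (Invertibleₘ A)
  invertibleₘ? {n} = Invertibles.invertible? (*ₘ-magma n) 1ₘ (finiteMatrices fin n)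

  weight : Matrix n → Carrier
  weight A = restrict (invertibleₘ? A) (λ _ → χ₀ (det A) * ψ₁ (tr A))

  total : ℕ → Carrier
  total n = sumOver (finiteMatrices fin n) weight

  sumGL-total : ∀ n → sumGL n ≈ total n
  sumGL-total n = listSum-units (*ₘ-magma n) 1ₘ (finiteMatrices fin n) (λ (g , _) → χ₀ (det g) * ψ₁ (tr g))

  -- Common form of the two vanishing arguments: scaling the top row takes `t` to be `1#`,
  -- translating it takes `u zero` to be `F.1#`.
  weight-rowOp : (u : Vector F.Carrier (suc n)) (u₀-unit : Invertible (u zero))
                 (A B : Matrix (suc n)) (t : Carrier) →
                 (∀ i j → rowOp u A i j F.≈ B i j) → ψ₁ (tr B) ≈ t * ψ₁ (tr A) →
                 weight B ≈ χ₁ (u zero , u₀-unit) * t * weight A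
  weight-rowOp u u₀-unit A B t uA≈B ψB = restrict-scale {P? = invertibleₘ? B} {invertibleₘ? A} _
    (λ B-inv → rowOp-invertible⁻ u u₀-unit A (Invertibleₘ-resp (λ i j → F.sym (uA≈B i j)) B-inv))
    (λ A-inv → Invertibleₘ-resp uA≈B (rowOp-invertible⁺ u u₀-unit A A-inv))
    (λ _ _ → begin
      χ₀ (det B) * ψ₁ (tr B)
        ≈⟨ *-cong (χ₀-cong (F.trans (F.sym (det-cong uA≈B)) (det-rowOp u A))) ψB ⟩
      χ₀ (u zero F.* det A) * (t * ψ₁ (tr A))
        ≈⟨ *-congʳ (χ₀-* (u zero , u₀-unit) (det A)) ⟩
      χ₁ (u zero , u₀-unit) * χ₀ (det A) * (t * ψ₁ (tr A))
        ≈⟨ solve 4 (λ a b c d → (a :* b) :* (c :* d) := (a :* c) :* (b :* d)) refl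
             (χ₁ (u zero , u₀-unit)) (χ₀ (det A)) t (ψ₁ (tr A)) ⟩
      χ₁ (u zero , u₀-unit) * t * (χ₀ (det A) * ψ₁ (tr A)) ∎)

  weight-cong : {A B : Matrix n} → (∀ i j → A i j F.≈ B i j) → weight A ≈ weight B
  weight-cong {A = A} {B} A≈B = restrict-cong {P? = invertibleₘ? A} {invertibleₘ? B}
    (Invertibleₘ-resp A≈B) (Invertibleₘ-resp (λ i j → F.sym (A≈B i j)))
    (λ _ _ → *-cong (χ₀-cong (det-cong A≈B)) (ψ₁-cong (sum-cong-≋ (λ i → A≈B i i))))

  gaussTerm : F.Carrier → Carrier
  gaussTerm x = restrict (invertible? fin x) (λ x-unit → χ₁ (x , x-unit) * ψ₁ x)

  gaussSum-gaussTerm : gaussSum ≈ sumOver fin gaussTerm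
  gaussSum-gaussTerm = listSum-units F.*-magma F.1# fin (λ u → χ₁ u * ψ₁ (proj₁ u))

  -- Invertibility, determinant and trace all split into a contribution of the corner and one of the
  -- minor.
  weight-upper : (A : Matrix (suc n)) → (∀ i → A (suc i) zero F.≈ F.0#) →
                 weight A ≈ gaussTerm (A zero zero) * weight (minor zero A)
  weight-upper A A₁₀≈0 = restrict-*
    {P? = invertibleₘ? A} {invertible? fin (A zero zero)} {invertibleₘ? (minor zero A)}
    (upper-invertible⁻ A A₁₀≈0) (upper-invertible⁺ A A₁₀≈0)
    (λ _ a-unit h-inv → begin
      χ₀ (det A) * ψ₁ (A zero zero F.+ tr h)
        ≈⟨ *-cong
             (trans (χ₀-cong (det-upper A A₁₀≈0 a-unit h-inv)) (χ₀-* (A zero zero , a-unit) (det h)))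
             (ψ.homo (A zero zero) (tr h)) ⟩
      χ₁ (A zero zero , a-unit) * χ₀ (det h) * (ψ₁ (A zero zero) * ψ₁ (tr h))
        ≈⟨ solve 4 (λ a b c d → (a :* b) :* (c :* d) := (a :* c) :* (b :* d)) refl
             (χ₁ (A zero zero , a-unit)) (χ₀ (det h)) (ψ₁ (A zero zero)) (ψ₁ (tr h)) ⟩
      χ₁ (A zero zero , a-unit) * ψ₁ (A zero zero) * (χ₀ (det h) * ψ₁ (tr h)) ∎)
    where h = minor zero A

  private
    finRow : ∀ n → Finite (VectorSetoid F.setoid n) (q ℕ.^ n)
    finRow = finiteVectors fin

    finLower : ∀ n → Finite (VectorSetoid (VectorSetoid F.setoid (suc n)) n) ((q ℕ.^ suc n) ℕ.^ n)
    finLower n = finiteVectors (finRow (suc n)) n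

  rowSum : Vector (Vector F.Carrier (suc n)) n → Carrier
  rowSum {n} B = sumOver (finRow (suc n)) (λ r → weight (r ∷ B))

  rowSum-cong : {B B′ : Vector (Vector F.Carrier (suc n)) n} → (∀ i j → B i j F.≈ B′ i j) → rowSum B ≈ rowSum B′
  rowSum-cong {n} {B} {B′} B≈B′ = sumOver-cong (finRow (suc n)) λ r →
    weight-cong {A = r ∷ B} {r ∷ B′} λ { zero j → F.refl ; (suc i) j → B≈B′ i j }

  total-rowSum : ∀ n → total (suc n) ≈ sumOver (finLower n) rowSum
  total-rowSum n = trans
    (sumOver-∷ (finRow (suc n)) weight weight-cong)
    (sumOver-comm (finRow (suc n)) (finLower n) (λ r B → weight (r ∷ B)))

  scaling : Unit → Inverse (VectorSetoid F.setoid n) (VectorSetoid F.setoid n)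
  scaling (x , y , yx , xy) = record
    { to        = λ r j → x F.* r j
    ; from      = λ r j → y F.* r j
    ; to-cong   = λ r≈s j → F.*-congˡ (r≈s j)
    ; from-cong = λ r≈s j → F.*-congˡ (r≈s j)
    ; inverse   = (λ {r} s≈yr j → F.trans (F.*-congˡ (s≈yr j)) (cancel xy (r j)))
                , (λ {r} s≈xr j → F.trans (F.*-congˡ (s≈xr j)) (cancel yx (r j)))
    }
    where
    cancel : ∀ {x y} → x F.* y F.≈ F.1# → ∀ z → x F.* (y F.* z) F.≈ z
    cancel xy z = F.trans (F.sym (F.*-assoc _ _ z)) (F.trans (F.*-congʳ xy) (F.*-identityˡ z))

  translation : Vector F.Carrier n → Inverse (VectorSetoid F.setoid n) (VectorSetoid F.setoid n)
  translation w = record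
    { to        = λ r j → r j F.+ w j
    ; from      = λ r j → r j F.+ F.- w j
    ; to-cong   = λ r≈s j → F.+-congʳ (r≈s j)
    ; from-cong = λ r≈s j → F.+-congʳ (r≈s j)
    ; inverse   = (λ {r} s≈ j → F.trans (F.+-congʳ (s≈ j)) (cancel (F.-‿inverseˡ (w j)) (r j)))
                , (λ {r} s≈ j → F.trans (F.+-congʳ (s≈ j)) (cancel (F.-‿inverseʳ (w j)) (r j)))
    }
    where
    cancel : ∀ {x y} → x F.+ y F.≈ F.0# → ∀ z → z F.+ x F.+ y F.≈ z
    cancel xy z = F.trans (F.+-assoc z _ _) (F.trans (F.+-congˡ xy) (F.+-identityʳ z))

  -- Trivial additive character.

  module _ (ψ-trivial : Trivial (F ⁺) K ψ) where

    sumGL-trivial : Trivial (F ˣ) K χ → ∀ n → sumGL n ≈ fromℕ (orderGL n)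
    sumGL-trivial χ-trivial n = listSum-ones (elementsGL fin n) λ (g , g-inv) → begin
      χ₀ (det g) * ψ₁ (tr g)
        -- A determinant that was not a unit would contribute the default value `0#` of `χ₀` instead
        -- of `1#`.
        ≈⟨ *-cong (trans (χ₀-unit (det g , det-invertible unit-or-zero g g-inv)) (χ-trivial _))
             (ψ-trivial (tr g)) ⟩
      1# * 1#  ≈⟨ *-identityˡ 1# ⟩
      1#       ∎

    χ-rowSum : (u : Unit) (B : Vector (Vector F.Carrier (suc n)) n) → χ₁ u * rowSum B ≈ rowSum B
    χ-rowSum {n} u@(x , x-unit) B = begin
      χ₁ u * rowSum B
        ≈⟨ *-distribˡ-sumOver (finRow (suc n)) (χ₁ u) (λ r → weight (r ∷ B)) ⟩
      sumOver (finRow (suc n)) (λ r → χ₁ u * weight (r ∷ B))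
        ≈⟨ sumOver-cong (finRow (suc n)) (λ r → trans (*-congʳ (sym (*-identityʳ (χ₁ u))))
             (sym (weight-rowOp v x-unit (r ∷ B) ((λ j → x F.* r j) ∷ B) 1# (v-rowOp r)
               -- Scaling the row also changes the trace, which a trivial `ψ` does not see.
               (trans (ψ-trivial _) (trans (sym (ψ-trivial _)) (sym (*-identityˡ _))))))) ⟩
      sumOver (finRow (suc n)) (λ r → weight ((λ j → x F.* r j) ∷ B))
        ≈⟨ sumOver-reindex (finRow (suc n)) (finRow (suc n)) (scaling u) {λ r → weight (r ∷ B)}
             (λ {r} {s} r≈s → weight-cong {A = r ∷ B} {s ∷ B} λ { zero j → r≈s j ; (suc i) j → F.refl }) ⟨
      rowSum B ∎
      where
      v : Vector F.Carrier (suc n)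
      v = x ∷ (λ _ → F.0#)

      v-rowOp : ∀ r i j → rowOp v (r ∷ B) i j F.≈ ((λ j → x F.* r j) ∷ B) i j
      v-rowOp r zero    j = F.trans (F.+-congˡ (sum-zero (λ k → F.zeroˡ (B k j)))) (F.+-identityʳ _)
      v-rowOp r (suc i) j = F.refl

    sumGL-nontrivial : ¬ Trivial (F ˣ) K χ → ∀ n → sumGL (suc n) ≈ 0#
    sumGL-nontrivial χ-nontrivial n = begin
      sumGL (suc n)                 ≈⟨ sumGL-total (suc n) ⟩
      total (suc n)                 ≈⟨ total-rowSum n ⟩
      sumOver (finLower n) rowSum   ≈⟨ sumOver-zero (finLower n) (λ B →
                                         vanishing χ₁ (rowSum B) (λ u → χ-rowSum u B) χ-nontrivial) ⟩
      0#                            ∎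

  ψ-rowSum : (v : Vector F.Carrier n) (B : Vector (Vector F.Carrier (suc n)) n) →
             ψ₁ (sum (λ i → v i F.* B i zero)) * rowSum B ≈ rowSum B
  ψ-rowSum {n} v B = begin
    t * rowSum B
      ≈⟨ *-distribˡ-sumOver (finRow (suc n)) t (λ r → weight (r ∷ B)) ⟩
    sumOver (finRow (suc n)) (λ r → t * weight (r ∷ B))
      ≈⟨ sumOver-cong (finRow (suc n)) (λ r → trans
           (*-congʳ (trans (sym (*-identityˡ t)) (*-congʳ (sym χ-1))))
           (sym (weight-rowOp (F.1# ∷ v) 1-unit (r ∷ B) ((λ j → r j F.+ w j) ∷ B) t (v-rowOp r) (ψ-shift r)))) ⟩
    sumOver (finRow (suc n)) (λ r → weight ((λ j → r j F.+ w j) ∷ B))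
      ≈⟨ sumOver-reindex (finRow (suc n)) (finRow (suc n)) (translation w) {λ r → weight (r ∷ B)}
           (λ {r} {s} r≈s → weight-cong {A = r ∷ B} {s ∷ B} λ { zero j → r≈s j ; (suc i) j → F.refl }) ⟨
    rowSum B ∎
    where
    w : Vector F.Carrier (suc n)
    w j = sum (λ i → v i F.* B i j)

    t : Carrier
    t = ψ₁ (w zero)

    1-unit : Invertible F.1#
    1-unit = F.1# , F.*-identityˡ F.1# , F.*-identityˡ F.1#

    χ-1 : χ₁ (F.1# , 1-unit) ≈ 1#
    χ-1 = χ.ε-homo

    v-rowOp : ∀ r i j → rowOp (F.1# ∷ v) (r ∷ B) i j F.≈ ((λ j → r j F.+ w j) ∷ B) i j
    v-rowOp r zero    j = F.+-congʳ (F.*-identityˡ (r j))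
    v-rowOp r (suc i) j = F.refl

    ψ-shift : ∀ r → ψ₁ (tr ((λ j → r j F.+ w j) ∷ B)) ≈ t * ψ₁ (tr (r ∷ B))
    ψ-shift r = trans
      (ψ₁-cong (F.trans (F.+-congʳ (F.+-comm (r zero) (w zero))) (F.+-assoc (w zero) (r zero) _)))
      (ψ.homo (w zero) (tr (r ∷ B)))

  -- The recursion starts from the empty matrix, which is its own inverse, with determinant `F.1#`
  -- and trace `F.0#`.
  total-zero : total 0 ≈ 1#
  total-zero = begin
    total 0
      ≈⟨ sumOver-[] (finRow 0) weight (λ {A} {B} → weight-cong {A = A} {B}) ⟩
    weight {0} []
      ≈⟨ restrict-cong {P? = invertibleₘ? {0} []} {yes ε-inv} (λ _ → ε-inv) (λ _ → ε-inv) (λ _ _ → refl) ⟩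
    χ₀ F.1# * ψ₁ F.0#
      ≈⟨ *-cong (trans (χ₀-unit (F.1# , F.1# , F.*-identityˡ F.1# , F.*-identityˡ F.1#)) χ.ε-homo) ψ.ε-homo ⟩
    1# * 1#
      ≈⟨ *-identityˡ 1# ⟩
    1# ∎
    where
    ε-inv : Invertibleₘ {0} []
    ε-inv = [] , (λ ()) , (λ ())

  choose₂-suc : ∀ n → suc n C 2 ≡ n ℕ.+ n C 2
  choose₂-suc n = ≡.trans (≡.sym (nCk+nC[k+1]≡[n+1]C[k+1] n 1)) (≡.cong (ℕ._+ n C 2) (nC1≡n n))

  -- Nontrivial additive character.

  module _ (ψ-nontrivial : ¬ Trivial (F ⁺) K ψ) where

    -- Every value `ψ₁ x` has to be realised by a shift of the trace. With `b` the inverse of a unit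
    -- entry `B i zero`, adding `x F.* b` times row `i` of `B` to the top row shifts it by exactly
    -- `x`.
    rowSum-zero : (B : Vector (Vector F.Carrier (suc n)) n) → ¬ (∀ i → B i zero F.≈ F.0#) → rowSum B ≈ 0#
    rowSum-zero B B₀≉0 with someUnit unit-or-zero (λ i → B i zero)
    ... | inj₂ B₀≈0 = contradiction B₀≈0 B₀≉0
    ... | inj₁ (i , b , bBᵢ₀ , _) = vanishing ψ₁ (rowSum B)
      (λ x → trans (*-congʳ (ψ₁-cong (F.sym (dot x)))) (ψ-rowSum (λ k → x F.* b F.* 1ₘ i k) B)) ψ-nontrivial
      where
      dot : ∀ x → sum (λ k → x F.* b F.* 1ₘ i k F.* B k zero) F.≈ x
      dot x = F.trans (sum-cong-≋ (λ k → F.*-assoc (x F.* b) (1ₘ i k) (B k zero)))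
        (F.trans (F.sym (*-distribˡ-sum (x F.* b) (λ k → 1ₘ i k F.* B k zero)))
        (F.trans (F.*-congˡ (sum-1ₘˡ i (λ k → B k zero)))
        (F.trans (F.*-assoc x b (B i zero)) (F.trans (F.*-congˡ bBᵢ₀) (F.*-identityʳ x)))))

    -- The corner runs through `F` and yields the Gauss sum; the other `n` entries of the top row
    -- leave the weight unchanged and only count.
    rowSum-upper : (h : Matrix n) → rowSum (λ i → F.0# ∷ h i) ≈ fromℕ (q ℕ.^ n) * gaussSum * weight h
    rowSum-upper {n} h = begin
      sumOver (finRow (suc n)) (λ r → weight (r ∷ B))
        ≈⟨ sumOver-cong (finRow (suc n)) (λ r → weight-upper (r ∷ B) (λ _ → F.refl)) ⟩
      sumOver (finRow (suc n)) (λ r → gaussTerm (r zero) * weight h)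
        ≈⟨ sumOver-∷ fin {n = n} (λ r → gaussTerm (r zero) * weight h)
             (λ r≈s → *-congʳ (gaussTerm-cong (r≈s zero))) ⟩
      sumOver fin (λ x → sumOver (finRow n) (λ _ → gaussTerm x * weight h))
        ≈⟨ sumOver-cong fin (λ x → sumOver-const (finRow n) (gaussTerm x * weight h)) ⟩
      sumOver fin (λ x → fromℕ (q ℕ.^ n) * (gaussTerm x * weight h))
        ≈⟨ *-distribˡ-sumOver fin (fromℕ (q ℕ.^ n)) (λ x → gaussTerm x * weight h) ⟨
      fromℕ (q ℕ.^ n) * sumOver fin (λ x → gaussTerm x * weight h)
        ≈⟨ *-congˡ (*-distribʳ-sumOver fin (weight h) gaussTerm) ⟨
      fromℕ (q ℕ.^ n) * (sumOver fin gaussTerm * weight h)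
        ≈⟨ *-congˡ (*-congʳ gaussSum-gaussTerm) ⟨
      fromℕ (q ℕ.^ n) * (gaussSum * weight h)
        ≈⟨ *-assoc _ _ _ ⟨
      fromℕ (q ℕ.^ n) * gaussSum * weight h ∎
      where
      B : Vector (Vector F.Carrier (suc n)) n
      B i = F.0# ∷ h i

      gaussTerm-cong : ∀ {x y} → x F.≈ y → gaussTerm x ≈ gaussTerm y
      gaussTerm-cong {x} {y} x≈y = restrict-cong {P? = invertible? fin x} {invertible? fin y}
        (Invertible-resp x≈y) (Invertible-resp (F.sym x≈y))
        (λ x-unit y-unit → *-cong (χ₁-cong {x , x-unit} {y , y-unit} x≈y) (ψ₁-cong x≈y))

    total-suc : ∀ n → total (suc n) ≈ fromℕ (q ℕ.^ n) * gaussSum * total n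
    total-suc n = begin
      total (suc n)
        ≈⟨ total-rowSum n ⟩
      sumOver (finLower n) rowSum
        ≈⟨ sumOver-columns fin {n = n} {k = n} rowSum (λ {B} {B′} → rowSum-cong {B = B} {B′}) ⟩
      sumOver (finRow n) columnSum
        ≈⟨ sumOver-single (finRow n) {columnSum}
             (λ {c} {c′} c≈c′ → sumOver-cong (finiteMatrices fin n) (λ h →
               rowSum-cong {B = λ i → c i ∷ h i} {λ i → c′ i ∷ h i}
                 (λ { i zero → c≈c′ i ; i (suc j) → F.refl })))
             (λ _ → F.0#)
             (λ c c≉0 → sumOver-zero (finiteMatrices fin n) (λ h → rowSum-zero (λ i → c i ∷ h i) c≉0)) ⟩
      sumOver (finiteMatrices fin n) (λ h → rowSum (λ i → F.0# ∷ h i))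
        ≈⟨ sumOver-cong (finiteMatrices fin n) rowSum-upper ⟩
      sumOver (finiteMatrices fin n) (λ h → fromℕ (q ℕ.^ n) * gaussSum * weight h)
        ≈⟨ *-distribˡ-sumOver (finiteMatrices fin n) (fromℕ (q ℕ.^ n) * gaussSum) weight ⟨
      fromℕ (q ℕ.^ n) * gaussSum * total n ∎
      where
      columnSum : Vector F.Carrier n → Carrier
      columnSum c = sumOver (finiteMatrices fin n) (λ h → rowSum (λ i → c i ∷ h i))

    total-gaussSum : ∀ n → total n ≈ fromℕ (q ℕ.^ (n C 2)) * gaussSum ^ n
    -- `0 C 2` is zero, so the first factor is `fromℕ 1`, which unfolds to `1# + 0#`.
    total-gaussSum zero    = trans total-zero (sym (trans (*-identityʳ _) (+-identityʳ 1#)))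
    total-gaussSum (suc n) = begin
      total (suc n)
        ≈⟨ total-suc n ⟩
      fromℕ (q ℕ.^ n) * gaussSum * total n
        ≈⟨ *-congˡ (total-gaussSum n) ⟩
      fromℕ (q ℕ.^ n) * gaussSum * (fromℕ (q ℕ.^ (n C 2)) * gaussSum ^ n)
        ≈⟨ solve 4 (λ a b c d → (a :* b) :* (c :* d) := (a :* c) :* (b :* d)) refl
             (fromℕ (q ℕ.^ n)) gaussSum (fromℕ (q ℕ.^ (n C 2))) (gaussSum ^ n) ⟩
      fromℕ (q ℕ.^ n) * fromℕ (q ℕ.^ (n C 2)) * gaussSum ^ suc n
        ≈⟨ *-congʳ (×1-homo-* (q ℕ.^ n) (q ℕ.^ (n C 2))) ⟨
      fromℕ (q ℕ.^ n ℕ.* q ℕ.^ (n C 2)) * gaussSum ^ suc n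
        ≡⟨ ≡.cong (λ m → fromℕ m * gaussSum ^ suc n) (≡.trans
             (≡.sym (ℕ.^-distribˡ-+-* q n (n C 2))) (≡.cong (q ℕ.^_) (≡.sym (choose₂-suc n)))) ⟩
      fromℕ (q ℕ.^ (suc n C 2)) * gaussSum ^ suc n ∎

theorem1 : ∀ {c ℓ₁ ℓ₂ c′ ℓ₁′ ℓ₂′}
    (q : ℕ) → IsPrimePower q →
    (F : HeytingField c ℓ₁ ℓ₂) (fin : Finite (setoidOf F) q)
    (K : HeytingField c′ ℓ₁′ ℓ₂′) → CharacteristicZero K →
    (χ : Character (F ˣ) K) (ψ : Character (F ⁺) K)
    (n : ℕ) → 1 ≤ n →
    let open CharacterSums F fin K χ ψ in
    (Trivial (F ⁺) K ψ → Trivial (F ˣ) K χ → sumGL n ≈ fromℕ (orderGL n)) ×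
    (Trivial (F ⁺) K ψ → ¬ Trivial (F ˣ) K χ → sumGL n ≈ 0#) ×
    (¬ Trivial (F ⁺) K ψ → sumGL n ≈ fromℕ (q ℕ.^ (n C 2)) * gaussSum ^ n)
theorem1 q _ F fin K _ χ ψ (suc n) _ =
    (λ ψ-trivial χ-trivial → sumGL-trivial ψ-trivial χ-trivial (suc n))
  , (λ ψ-trivial χ-nontrivial → sumGL-nontrivial ψ-trivial χ-nontrivial n)
  , (λ ψ-nontrivial → CommutativeRing.trans (ringOf K)
      (sumGL-total (suc n)) (total-gaussSum ψ-nontrivial (suc n)))
  where open GaussSumsOverGL F fin K χ ψ
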